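{- Let $P$ be an $n$-dimensional, simple polytope given by a minimal representation. All circuit walks in $P$ are edge walks if and only if $P$ is an $(n,d)$-parallelotope for some $d\in\{1,\dots,n\}$.
   Context: A polytope $P=\{x: Ax=b,\ Bx\le d\}$ ($A,B$ rational) is given by a minimal representation if every inequality defines a facet. $P$ is simple if each vertex lies in exactly $\dim P$ facets. Circuits: $\mathcal C(A,B)$ is the set of $g\in\ker(A)\setminus\{0\}$ with coprime integer components such that the support of $Bg$ is inclusion-minimal among supports of $Bx$, $x\in\ker(A)\setminus\{0\}$. A circuit walk between vertices $v^{(1)},v^{(2)}$ is a sequence $v^{(1)}=y^{(0)},\dots,y^{(k)}=v^{(2)}$ with $y^{(i)}\in P$, $y^{(i+1)}=y^{(i)}+\alpha_i g^{(i)}$ for some $g^{(i)}\in\mathcal C(A,B)$, $\alpha_i>0$, and $y^{(i)}+\alpha g^{(i)}\notin P$ for all $\alpha>\alpha_i$; it is an edge walk if each $y^{(i)}$ is a vertex and each $[y^{(i)},y^{(i+1)}]$ is an edge of $P$. For vertices $u,v$, $P^{uv}$ is the inclusion-minimal face containing both, and $I^{uv}(u)=\{g: u+\varepsilon g\in P^{uv}\text{ for some }\varepsilon>0\}$. $P$ satisfies the symmetric inner cone condition if $I^{uv}(u)=-I^{uv}(v)$ for all pairs of vertices $u,v$. A $d$-parallelotope is a set $a+\{\sum_{i=1}^d\lambda_i w_i: \lambda_i\in[0,1]\}$ with $w_1,\dots,w_d$ linearly independent (a polytope with $d$ pairs of parallel opposite facets and $2^d$ vertices). For $d\in\{1,\dots,n\}$,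 an $(n,d)$-parallelotope is an $n$-dimensional polytope with $n+d$ facets that satisfies the symmetric inner cone condition and in which every vertex belongs to a face that is a $d$-parallelotope.
   Formalization: The right-hand sides b and d are taken rational, as A and B are, and the polytope, its points, directions and step lengths are considered over the rationals instead of the reals. -}

module Defs where

open import Level using (0ℓ)
open import Data.Nat as ℕ using (ℕ; zero; suc)
open import Data.Nat.Divisibility using (_∣_)
open import Data.Integer as ℤ using (ℤ)
open import Data.Rational using (ℚ; 0ℚ; 1ℚ; _+_; _*_; _-_; -_; _≤_; _<_; _/_)
open import Data.Fin using (Fin; zero; suc; fromℕ; inject₁)
open import Data.Product using (Σ; ∃; _×_; _,_)
open import Data.Unit using (⊤)
open import Relation.Nullary using (¬_)
open import Relation.Binary.PropositionalEquality using (_≡_)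

-- Points of ℚ^N (all data of the polytope is rational)
Pt : ℕ → Set
Pt N = Fin N → ℚ

sumF : (k : ℕ) → (Fin k → ℚ) → ℚ
sumF zero    f = 0ℚ
sumF (suc k) f = f zero + sumF k (λ i → f (suc i))

dot : {N : ℕ} → Pt N → Pt N → ℚ
dot {N} u v = sumF N (λ i → u i * v i)

_≈_ : {N : ℕ} → Pt N → Pt N → Set
x ≈ y = ∀ i → x i ≡ y i

_+[_]·_ : {N : ℕ} → Pt N → ℚ → Pt N → Pt N
(y +[ α ]· g) i = y i + α * g i

neg : {N : ℕ} → Pt N → Pt N
neg g i = - (g i)

PSet : ℕ → Set₁
PSet N = Pt N → Set

SameSet : {N : ℕ} → PSet N → PSet N → Set
SameSet F G = ∀ x → (F x → G x) × (G x → F x)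

-- the system  Ax = b, Bx ≤ d
record System (N : ℕ) : Set where
  field
    m₁ m₂ : ℕ
    A : Fin m₁ → Pt N
    b : Fin m₁ → ℚ
    B : Fin m₂ → Pt N
    d : Fin m₂ → ℚ

module _ {N : ℕ} (S : System N) where
  open System S

  InP : PSet N
  InP x = (∀ i → dot (A i) x ≡ b i) × (∀ j → dot (B j) x ≤ d j)

  Bounded : Set
  Bounded = ∃ λ M → ∀ x → InP x → ∀ i → (- M ≤ x i) × (x i ≤ M)

LinIndep : {N : ℕ} (k : ℕ) → (Fin k → Pt N) → Set
LinIndep {N} k w = ∀ (λs : Fin k → ℚ) →
  (∀ j → sumF k (λ i → λs i * w i j) ≡ 0ℚ) → ∀ i → λs i ≡ 0ℚ

AffIndep : {N : ℕ} (k : ℕ) → (Fin (suc k) → Pt N) → Set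
AffIndep k p = LinIndep k (λ i j → p (suc i) j - p zero j)

HasDim : {N : ℕ} → PSet N → ℕ → Set
HasDim {N} F k =
  (∃ λ (p : Fin (suc k) → Pt N) → (∀ i → F (p i)) × AffIndep k p) ×
  ¬ (∃ λ (p : Fin (suc (suc k)) → Pt N) → (∀ i → F (p i)) × AffIndep (suc k) p)

IsParallelotope : {N : ℕ} → ℕ → PSet N → Set
IsParallelotope {N} k F = ∃ λ (a : Pt N) → ∃ λ (w : Fin k → Pt N) → LinIndep k w ×
  SameSet F (λ x → ∃ λ (λs : Fin k → ℚ) → (∀ i → (0ℚ ≤ λs i) × (λs i ≤ 1ℚ)) ×
    x ≈ (λ j → a j + sumF k (λ i → λs i * w i j)))

module _ {N : ℕ} (S : System N) where
  open System S

  Face : PSet N → Set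
  Face F = ∃ λ (c : Pt N) → ∃ λ (δ : ℚ) →
    (∀ x → InP S x → dot c x ≤ δ) ×
    SameSet F (λ x → InP S x × dot c x ≡ δ) ×
    ∃ F

  IsFacet : PSet N → Set
  IsFacet F = Face F × ∃ λ k → HasDim (InP S) (suc k) × HasDim F k

  Vertex : Pt N → Set
  Vertex v = Face (λ x → x ≈ v)

  Segment : Pt N → Pt N → PSet N
  Segment y y' x = ∃ λ t → (0ℚ ≤ t) × (t ≤ 1ℚ) × x ≈ (y +[ t ]· (λ i → y' i - y i))

  Edge : Pt N → Pt N → Set
  Edge y y' = Face (Segment y y') × HasDim (Segment y y') 1

  MinimalRep : Set
  MinimalRep = ∀ j → IsFacet (λ x → InP S x × dot (B j) x ≡ d j)

  ExactlyFacets : (PSet N → Set) → ℕ → Set₁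
  ExactlyFacets Q k = ∃ λ (F : Fin k → PSet N) →
    (∀ i → IsFacet (F i) × Q (F i)) ×
    (∀ i j → SameSet (F i) (F j) → i ≡ j) ×
    (∀ G → IsFacet G → Q G → ∃ λ i → SameSet G (F i))

  Simple : ℕ → Set₁
  Simple n = ∀ v → Vertex v → ExactlyFacets (λ F → F v) n

  toQ : (Fin N → ℤ) → Pt N
  toQ g i = g i / 1

  InKer : Pt N → Set
  InKer x = ∀ i → dot (A i) x ≡ 0ℚ

  NonZeroPt : Pt N → Set
  NonZeroPt x = ¬ (∀ j → x j ≡ 0ℚ)

  CoprimeComps : (Fin N → ℤ) → Set
  CoprimeComps g = ∀ (k : ℕ) → (∀ j → k ∣ ℤ.∣ g j ∣) → k ≡ 1

  SuppStrictSub : Pt N → Pt N → Set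
  SuppStrictSub x y =
    (∀ i → ¬ dot (B i) x ≡ 0ℚ → ¬ dot (B i) y ≡ 0ℚ) ×
    (∃ λ i → ¬ dot (B i) y ≡ 0ℚ × dot (B i) x ≡ 0ℚ)

  Circuit : (Fin N → ℤ) → Set
  Circuit g = InKer (toQ g) × NonZeroPt (toQ g) × CoprimeComps g ×
    ¬ (∃ λ x → InKer x × NonZeroPt x × SuppStrictSub x (toQ g))

  CircuitStep : Pt N → Pt N → Set
  CircuitStep y y' = ∃ λ g → Circuit g × ∃ λ α → (0ℚ < α) ×
    y' ≈ (y +[ α ]· toQ g) ×
    (∀ α' → α < α' → ¬ InP S (y +[ α' ]· toQ g))

  CircuitWalk : Pt N → Pt N → (k : ℕ) → (Fin (suc k) → Pt N) → Set
  CircuitWalk v₁ v₂ k y = y zero ≈ v₁ × y (fromℕ k) ≈ v₂ ×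
    (∀ i → InP S (y i)) ×
    (∀ (i : Fin k) → CircuitStep (y (inject₁ i)) (y (suc i)))

  EdgeWalk : Pt N → Pt N → (k : ℕ) → (Fin (suc k) → Pt N) → Set
  EdgeWalk v₁ v₂ k y = CircuitWalk v₁ v₂ k y × (∀ i → Vertex (y i)) ×
    (∀ (i : Fin k) → Edge (y (inject₁ i)) (y (suc i)))

  AllCircuitWalksAreEdgeWalks : Set
  AllCircuitWalksAreEdgeWalks = ∀ v₁ v₂ → Vertex v₁ → Vertex v₂ →
    ∀ k y → CircuitWalk v₁ v₂ k y → EdgeWalk v₁ v₂ k y

  MinFace : Pt N → Pt N → PSet N → Set₁
  MinFace u v F = Face F × F u × F v ×
    (∀ G → Face G → G u → G v → ∀ x → F x → G x)

  InnerCone : PSet N → Pt N → Pt N → Set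
  InnerCone F u g = ∃ λ ε → (0ℚ < ε) × F (u +[ ε ]· g)

  SymmetricInnerCone : Set₁
  SymmetricInnerCone = ∀ u v → Vertex u → Vertex v → ∀ F → MinFace u v F →
    ∀ g → (InnerCone F u g → InnerCone F v (neg g)) ×
          (InnerCone F v (neg g) → InnerCone F u g)

  NDParallelotope : ℕ → ℕ → Set₁
  NDParallelotope n dd = HasDim (InP S) n × ExactlyFacets (λ _ → ⊤) (n ℕ.+ dd) ×
    SymmetricInnerCone ×
    (∀ v → Vertex v → ∃ λ F → Face F × F v × IsParallelotope dd F)

{-# OPTIONS --safe #-}
module Submission where

-- The bridge between the two sides is the cone property: a direction g feasible at a vertex u
-- never moves away from a facet that misses u.  At a simple vertex the feasible cone is spanned
-- by the basis e_i dual to the n tight rows, so it suffices to test g = e_i.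
--
-- Circuit walks ⇒ cone property: if row l decreases along e_i it increases along some e_k; a
-- support-minimal vector inside the combination β e_i + γ e_k that keeps row l constant is a
-- circuit leaving both facets at once, so its step is not an edge.  Symmetric inner cones ⇒ cone
-- property: facet l has a vertex v off facet r_i, and e_i lies in the inner cone of P^{uv} at u.
--
-- Cone property ⇒ circuit walks: a feasible circuit g = Σ a_i e_i satisfies supp e_i ⊆ supp g
-- whenever a_i > 0, since no cancellation can occur.  Cone property ⇒ parallelotope: in the basis
-- e_i at a vertex, P is a product of simplices: along each edge exactly one facet off the vertex
-- varies, and it is reached at the far end, so one edge per such facet spans a box.

open import Defs
open import Level using (0ℓ)
open import Data.Nat as ℕ using (ℕ; zero; suc)
import Data.Nat.Properties as ℕₚ
open import Data.Nat.Divisibility using (_∣_; ∣-trans; *-cancelʳ-∣; ∣1⇒≡1; *-monoˡ-∣; _∣0; 0∣⇒≡0)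
open import Data.Nat.GCD using (gcd; gcd[m,n]∣m; gcd[m,n]∣n; gcd-greatest)
open import Data.Integer as ℤ using (ℤ)
import Data.Integer.Properties as ℤₚ
import Data.Integer.Divisibility.Signed as Signed
open import Data.Rational hiding (neg)
open import Data.Rational.Properties
import Data.Rational.Unnormalised as ℚᵘ
import Data.Rational.Unnormalised.Properties as ℚᵘₚ
open import Data.Fin using (Fin; zero; suc; punchIn; inject₁)
open import Data.Fin.Properties as Finₚ using (any?; all?)
open import Data.Product using (∃; _×_; _,_; proj₁; proj₂)
open import Data.Sum using (_⊎_; inj₁; inj₂)
open import Data.Empty using (⊥; ⊥-elim)
open import Data.Unit using (⊤; tt)
open import Data.Maybe using (Maybe; just; nothing)
open import Data.Vec.Functional using (_∷_; insertAt)
open import Data.Vec.Functional.Properties using (insertAt-lookup; insertAt-punchIn)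
open import Relation.Nullary using (¬_; Dec; yes; no)
open import Relation.Nullary.Decidable using (decidable-stable; ¬?; _×-dec_)
open import Relation.Binary.PropositionalEquality
open import Relation.Binary.Definitions using (tri<; tri≈; tri>)
open import Function using (_∘_; id)
open import Tactic.RingSolver.Core.AlmostCommutativeRing using (AlmostCommutativeRing; fromCommutativeRing)
open import Tactic.RingSolver using (solve-∀)
open import Algebra.Properties.CommutativeMonoid.Sum +-0-commutativeMonoid using (sum; sum-remove)

-- Ordered field arithmetic and finite sums

-- The hypothesis on circuit walks speaks only of walks that start and end at vertices, so a single
-- circuit step says nothing until it has been continued to a vertex. Such a continuation is found
-- only up to double negation, since the circuits it uses come from support-minimal vectors that are
-- not computed. Every argument that needs one therefore aims at a stable goal: an inequality of
-- rationals, an equality of indices, or absurdity. For the same reason `d` cannot be read off a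
-- chosen vertex. It is fixed beforehand as the number of facets minus `n`, and only properties of
-- this number are proved with the help of a vertex. Faces are predicates on an infinite set of
-- points. To decide whether two rows define the same facet, each facet is replaced by finitely many
-- affinely independent points that span it.

isZero? : ∀ x → Maybe (0ℚ ≡ x)
isZero? x with 0ℚ ≟ x
... | yes p = just p
... | no  _ = nothing

ℚ-ring : AlmostCommutativeRing 0ℓ 0ℓ
ℚ-ring = fromCommutativeRing +-*-commutativeRing isZero?

0≤1 : 0ℚ ≤ 1ℚ
0≤1 = <⇒≤ (positive⁻¹ 1ℚ)

0<1 : 0ℚ < 1ℚ
0<1 = positive⁻¹ 1ℚ

0<½ : 0ℚ < ½
0<½ = positive⁻¹ ½

≤⇒0≤∸ : ∀ {a b} → a ≤ b → 0ℚ ≤ b - a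
≤⇒0≤∸ {a} {b} p = subst (_≤ b - a) (+-inverseʳ a) (+-monoˡ-≤ (- a) p)

<⇒0<∸ : ∀ {a b} → a < b → 0ℚ < b - a
<⇒0<∸ {a} {b} p = subst (_< b - a) (+-inverseʳ a) (+-monoˡ-< (- a) p)

≤-by : ∀ {a b t} → 0ℚ ≤ t → b - a ≡ t → a ≤ b
≤-by {a} {b} {t} p e = subst₂ _≤_ (+-identityʳ a) (trans (cong (a +_) (sym e)) (lem a b)) (+-monoʳ-≤ a p)
  where lem : ∀ a b → a + (b - a) ≡ b
        lem = solve-∀ ℚ-ring

<-by : ∀ {a b t} → 0ℚ < t → b - a ≡ t → a < b
<-by {a} {b} {t} p e = subst₂ _<_ (+-identityʳ a) (trans (cong (a +_) (sym e)) (lem a b)) (+-monoʳ-< a p)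
  where lem : ∀ a b → a + (b - a) ≡ b
        lem = solve-∀ ℚ-ring

≡-by : ∀ {a b t} → t ≡ 0ℚ → a - b ≡ t → a ≡ b
≡-by {a} {b} {t} p e = trans (lem a b) (trans (cong (_+ b) (trans e p)) (+-identityˡ b))
  where lem : ∀ a b → a ≡ (a - b) + b
        lem = solve-∀ ℚ-ring

0≤+ : ∀ {a b} → 0ℚ ≤ a → 0ℚ ≤ b → 0ℚ ≤ a + b
0≤+ p q = +-mono-≤ p q

0<+ : ∀ {a b} → 0ℚ < a → 0ℚ ≤ b → 0ℚ < a + b
0<+ p q = +-mono-<-≤ p q

0≤* : ∀ {a b} → 0ℚ ≤ a → 0ℚ ≤ b → 0ℚ ≤ a * b
0≤* {a} {b} p q = subst (_≤ a * b) (*-zeroʳ a) (*-monoˡ-≤-nonNeg a {{nonNegative p}} q)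

0<* : ∀ {a b} → 0ℚ < a → 0ℚ < b → 0ℚ < a * b
0<* {a} {b} p q = subst (_< a * b) (*-zeroʳ a) (*-monoʳ-<-pos a {{positive p}} q)

0≤- : ∀ {a} → a ≤ 0ℚ → 0ℚ ≤ - a
0≤- p = neg-antimono-≤ p

0<- : ∀ {a} → a < 0ℚ → 0ℚ < - a
0<- p = neg-antimono-< p

-≤0 : ∀ {a} → 0ℚ ≤ a → - a ≤ 0ℚ
-≤0 p = neg-antimono-≤ p

-<0 : ∀ {a} → 0ℚ < a → - a < 0ℚ
-<0 p = neg-antimono-< p

*-≤0 : ∀ {a b} → 0ℚ ≤ a → b ≤ 0ℚ → a * b ≤ 0ℚ
*-≤0 {a} {b} p q = ≤-by (0≤* p (0≤- q)) (lem a b)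
  where lem : ∀ a b → 0ℚ - a * b ≡ a * - b
        lem = solve-∀ ℚ-ring

neg-neg : ∀ a → - - a ≡ a
neg-neg = solve-∀ ℚ-ring

0≤-⁻¹ : ∀ {a} → 0ℚ ≤ - a → a ≤ 0ℚ
0≤-⁻¹ {a} p = subst (_≤ 0ℚ) (neg-neg a) (-≤0 p)

≤∧≢⇒< : ∀ {a b} → a ≤ b → a ≢ b → a < b
≤∧≢⇒< {a} {b} p q with <-cmp a b
... | tri< l _ _ = l
... | tri≈ _ e _ = ⊥-elim (q e)
... | tri> _ _ g = ⊥-elim (q (≤-antisym p (<⇒≤ g)))

-≡0 : ∀ {a} → - a ≡ 0ℚ → a ≡ 0ℚ
-≡0 {a} e = trans (sym (neg-neg a)) (cong -_ e)

abstract
  inverse : ∀ {a} → a ≢ 0ℚ → ∃ λ c → a * c ≡ 1ℚ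
  inverse {a} p = (1/ a) {{≢-nonZero p}} , *-inverseʳ a {{≢-nonZero p}}

*-cancel-0 : ∀ {a b} → a ≢ 0ℚ → a * b ≡ 0ℚ → b ≡ 0ℚ
*-cancel-0 {a} {b} a≢0 e with inverse a≢0
... | c , ac≡1 = trans (≡-by ac-1 (lem a b c)) (trans (cong (c *_) e) (*-zeroʳ c))
  where
  ac-1 : (1ℚ - a * c) * b ≡ 0ℚ
  ac-1 = trans (cong (λ x → (1ℚ - x) * b) ac≡1) (*-zeroˡ b)
  lem : ∀ a b c → b - c * (a * b) ≡ (1ℚ - a * c) * b
  lem = solve-∀ ℚ-ring

pos⇒≢0 : ∀ {a} → 0ℚ < a → a ≢ 0ℚ
pos⇒≢0 p e = <⇒≢ p (sym e)

0<-cancel : ∀ {a b} → 0ℚ < a → 0ℚ < a * b → 0ℚ < b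
0<-cancel {a} {b} p q = *-cancelˡ-<-nonNeg a {{pos⇒nonNeg a {{positive p}}}} (subst (_< a * b) (sym (*-zeroʳ a)) q)

0≤-cancel : ∀ {a b} → 0ℚ < a → 0ℚ ≤ a * b → 0ℚ ≤ b
0≤-cancel {a} {b} p q = *-cancelˡ-≤-pos a {{positive p}} (subst (_≤ a * b) (sym (*-zeroʳ a)) q)

abstract
  inverse⁺ : ∀ {a} → 0ℚ < a → ∃ λ c → 0ℚ < c × a * c ≡ 1ℚ
  inverse⁺ {a} p with inverse (pos⇒≢0 p)
  ... | c , e = c , 0<-cancel p (subst (0ℚ <_) (sym e) 0<1) , e

  quotient⁺ : ∀ {a b} → 0ℚ < a → 0ℚ < b → ∃ λ c → 0ℚ < c × c * a ≡ b
  quotient⁺ {a} {b} p q with inverse⁺ p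
  ... | c , c>0 , e = b * c , 0<* q c>0 , trans (lem a b c) (trans (cong (b *_) e) (*-identityʳ b))
    where lem : ∀ a b c → b * c * a ≡ b * (a * c)
          lem = solve-∀ ℚ-ring

sumF-cong : ∀ k {f g : Fin k → ℚ} → (∀ i → f i ≡ g i) → sumF k f ≡ sumF k g
sumF-cong zero    e = refl
sumF-cong (suc k) e = cong₂ _+_ (e zero) (sumF-cong k (e ∘ suc))

sumF-0 : ∀ k {f : Fin k → ℚ} → (∀ i → f i ≡ 0ℚ) → sumF k f ≡ 0ℚ
sumF-0 zero    e = refl
sumF-0 (suc k) e = cong₂ _+_ (e zero) (sumF-0 k (e ∘ suc))

sumF-+ : ∀ k (f g : Fin k → ℚ) → sumF k (λ i → f i + g i) ≡ sumF k f + sumF k g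
sumF-+ zero    f g = refl
sumF-+ (suc k) f g = trans (cong (f zero + g zero +_) (sumF-+ k (f ∘ suc) (g ∘ suc)))
                           (lem (f zero) (g zero) _ _)
  where lem : ∀ a b c d → a + b + (c + d) ≡ a + c + (b + d)
        lem = solve-∀ ℚ-ring

sumF-* : ∀ k c (f : Fin k → ℚ) → sumF k (λ i → c * f i) ≡ c * sumF k f
sumF-* zero    c f = sym (*-zeroʳ c)
sumF-* (suc k) c f = trans (cong (c * f zero +_) (sumF-* k c (f ∘ suc))) (sym (*-distribˡ-+ c _ _))

sumF-swap : ∀ k l (f : Fin k → Fin l → ℚ) →
  sumF k (λ i → sumF l (f i)) ≡ sumF l (λ j → sumF k (λ i → f i j))
sumF-swap zero    l f = sym (sumF-0 l (λ _ → refl))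
sumF-swap (suc k) l f = trans (cong (sumF l (f zero) +_) (sumF-swap k l (f ∘ suc)))
                              (sym (sumF-+ l (f zero) _))

sumF-≥0 : ∀ k {f : Fin k → ℚ} → (∀ i → 0ℚ ≤ f i) → 0ℚ ≤ sumF k f
sumF-≥0 zero    p = ≤-refl
sumF-≥0 (suc k) p = 0≤+ (p zero) (sumF-≥0 k (p ∘ suc))

sumF-mono : ∀ k {f g : Fin k → ℚ} → (∀ i → f i ≤ g i) → sumF k f ≤ sumF k g
sumF-mono zero    p = ≤-refl
sumF-mono (suc k) p = +-mono-≤ (p zero) (sumF-mono k (p ∘ suc))

sumF-term≤ : ∀ k {f : Fin k → ℚ} → (∀ i → 0ℚ ≤ f i) → ∀ i → f i ≤ sumF k f
sumF-term≤ (suc k) {f} p zero    =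
  subst (_≤ sumF (suc k) f) (+-identityʳ _) (+-monoʳ-≤ (f zero) (sumF-≥0 k (p ∘ suc)))
sumF-term≤ (suc k) {f} p (suc i) = ≤-trans (sumF-term≤ k (p ∘ suc) i)
  (subst (_≤ sumF (suc k) f) (+-identityˡ _) (+-monoˡ-≤ _ (p zero)))

sumF-single : ∀ k {f : Fin k → ℚ} s → (∀ i → i ≢ s → f i ≡ 0ℚ) → sumF k f ≡ f s
sumF-single (suc k) {f} zero    z = trans (cong (f zero +_) (sumF-0 k (λ i → z (suc i) λ ()))) (+-identityʳ _)
sumF-single (suc k) {f} (suc s) z =
  trans (cong₂ _+_ (z zero λ ()) (sumF-single k s (λ i n → z (suc i) (n ∘ Finₚ.suc-injective)))) (+-identityˡ _)

sumF≡sum : ∀ k (f : Fin k → ℚ) → sumF k f ≡ sum f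
sumF≡sum zero    f = refl
sumF≡sum (suc k) f = cong (f zero +_) (sumF≡sum k (f ∘ suc))

sumF-remove : ∀ k (i : Fin (suc k)) (f : Fin (suc k) → ℚ) →
  sumF (suc k) f ≡ f i + sumF k (f ∘ punchIn i)
sumF-remove k i f = trans (sumF≡sum (suc k) f)
  (trans (sum-remove {i = i} f) (cong (f i +_) (sym (sumF≡sum k (f ∘ punchIn i)))))

-- Linear algebra over ℚ

Dependent : ∀ k l → (Fin k → Pt l) → Set
Dependent k l f = ∃ λ (c : Fin k → ℚ) →
  (∃ λ i → c i ≢ 0ℚ) × (∀ j → sumF k (λ i → c i * f i j) ≡ 0ℚ)

-- Gaussian elimination with pivot vector `f p`: subtracting multiples of it clears coordinate
-- `zero`, which is then dropped. A relation among the reduced vectors lifts by giving `f p` the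
-- coefficient `cp`, which collects the subtracted multiples.
module Elimination k (f : Fin (suc (suc k)) → Pt (suc k)) (p : Fin (suc (suc k)))
                   (q : ℚ) (inv : f p zero * q ≡ 1ℚ) where
  reduced : Fin (suc k) → Pt k
  reduced i j = f (punchIn p i) (suc j) - f (punchIn p i) zero * q * f p (suc j)

  module _ (c : Fin (suc k) → ℚ) where
    cp : ℚ
    cp = - sumF (suc k) (λ i → c i * f (punchIn p i) zero * q)
    c' : Fin (suc (suc k)) → ℚ
    c' = insertAt c p cp
    split : ∀ j → sumF (suc (suc k)) (λ i → c' i * f i j) ≡
                  cp * f p j + sumF (suc k) (λ i → c i * f (punchIn p i) j)
    split j = trans (sumF-remove (suc k) p (λ i → c' i * f i j))
      (cong₂ _+_ (cong (_* f p j) (insertAt-lookup c p cp))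
        (sumF-cong (suc k) (λ i → cong (_* f (punchIn p i) j) (insertAt-punchIn c p cp i))))
    lem₂ : ∀ c x a q b → c * (x - a * q * b) ≡ c * x + (- b) * (c * a * q)
    lem₂ = solve-∀ ℚ-ring
    lem₃ : ∀ s b t → - s * b + t ≡ t + - b * s
    lem₃ = solve-∀ ℚ-ring
    via : ∀ j → cp * f p j + sumF (suc k) (λ i → c i * f (punchIn p i) j) ≡
                sumF (suc k) (λ i → c i * (f (punchIn p i) j - f (punchIn p i) zero * q * f p j))
    via j = trans (lem₃ (sumF (suc k) (λ i → c i * f (punchIn p i) zero * q)) (f p j) _)
      (sym (trans (sumF-cong (suc k) (λ i → lem₂ (c i) (f (punchIn p i) j) (f (punchIn p i) zero) q (f p j)))
           (trans (sumF-+ (suc k) (λ i → c i * f (punchIn p i) j) (λ i → - f p j * (c i * f (punchIn p i) zero * q)))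
             (cong (sumF (suc k) (λ i → c i * f (punchIn p i) j) +_)
              (sumF-* (suc k) (- f p j) (λ i → c i * f (punchIn p i) zero * q))))))
    lem₅ : ∀ c x q y → c * (x - x * q * y) ≡ c * x * (1ℚ - y * q)
    lem₅ = solve-∀ ℚ-ring

  lift : Dependent (suc k) k reduced → Dependent (suc (suc k)) (suc k) f
  lift (c , (i₀ , nz) , z) = c' c , (punchIn p i₀ , nz') , z'
    where
    nz' : c' c (punchIn p i₀) ≢ 0ℚ
    nz' e = nz (trans (sym (insertAt-punchIn c p (cp c) i₀)) e)
    z' : ∀ j → sumF (suc (suc k)) (λ i → c' c i * f i j) ≡ 0ℚ
    z' zero = trans (split c zero) (trans (via c zero) (sumF-0 (suc k) λ i →
      trans (lem₅ c (c i) (f (punchIn p i) zero) q (f p zero))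
        (trans (cong (λ y → c i * f (punchIn p i) zero * (1ℚ - y)) inv)
          (*-zeroʳ (c i * f (punchIn p i) zero)))))
    z' (suc j) = trans (split c (suc j)) (trans (via c (suc j)) (z j))

dependent : ∀ k (f : Fin (suc k) → Pt k) → Dependent (suc k) k f
dependent zero f = (λ _ → 1ℚ) , (zero , 1≢0) , λ ()
dependent (suc k) f with any? (λ i → ¬? (f i zero ≟ 0ℚ))
... | yes (p , fp≢0) = Elimination.lift k f p (proj₁ q) (proj₂ q)
                         (dependent k (Elimination.reduced k f p (proj₁ q) (proj₂ q)))
  where
  q : ∃ λ c → f p zero * c ≡ 1ℚ
  q = inverse fp≢0
... | no all0 = extend (dependent k (λ i j → f (suc i) (suc j)))
  where
  extend : Dependent (suc k) k (λ i j → f (suc i) (suc j)) → Dependent (suc (suc k)) (suc k) f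
  extend (c , (i₀ , nz) , z) = c' , (suc i₀ , nz) , z'
    where
    c' : Fin (suc (suc k)) → ℚ
    c' zero    = 0ℚ
    c' (suc i) = c i
    z' : ∀ j → sumF (suc (suc k)) (λ i → c' i * f i j) ≡ 0ℚ
    z' zero    = sumF-0 (suc (suc k)) {λ i → c' i * f i zero} λ i →
      trans (cong (c' i *_) (decidable-stable (f i zero ≟ 0ℚ) (λ n → all0 (i , n)))) (*-zeroʳ (c' i))
    z' (suc j) = trans (cong (_+ sumF (suc k) (λ i → c i * f (suc i) (suc j))) (*-zeroˡ (f zero (suc j))))
                   (trans (+-identityˡ _) (z j))

-- The vectors `y` and `w` are one too many for their dimension, hence dependent. Independence of
-- `w` forces a nonzero coefficient on `y`, and dividing by it solves for `y`.
solve-square : ∀ n (w : Fin n → Pt n) → LinIndep n w → ∀ (y : Pt n) →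
  ∃ λ (x : Fin n → ℚ) → ∀ j → sumF n (λ k → x k * w k j) ≡ y j
solve-square n w ind y with dependent n (λ { zero → y ; (suc k) → w k })
... | c , (i₀ , nz) , z with c zero ≟ 0ℚ
...   | yes c0 = ⊥-elim (nz (all0 i₀))
  where
  all0 : ∀ i → c i ≡ 0ℚ
  all0 zero    = c0
  all0 (suc i) = ind (c ∘ suc) (λ j → trans
    (sym (trans (cong (_+ sumF n (λ k → c (suc k) * w k j)) (trans (cong (_* y j) c0) (*-zeroˡ (y j)))) (+-identityˡ _)))
    (z j)) i
...   | no c0 with inverse c0
...     | q , e = (λ k → - q * c (suc k)) , λ j →
  trans (sumF-cong n (λ k → *-assoc (- q) (c (suc k)) (w k j)))
  (trans (sumF-* n (- q) (λ k → c (suc k) * w k j)) (fin j))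
  where
  lem : ∀ q c y s → - q * s - y ≡ - q * (c * y + s) + (c * q - 1ℚ) * y
  lem = solve-∀ ℚ-ring
  fin : ∀ j → - q * sumF n (λ k → c (suc k) * w k j) ≡ y j
  fin j = ≡-by (cong₂ _+_ (trans (cong (- q *_) (z j)) (*-zeroʳ (- q)))
                         (trans (cong (λ t → (t - 1ℚ) * y j) e) (*-zeroˡ (y j))))
               (lem q (c zero) (y j) _)

-- As in the simplex method, `α` is the least quotient of `s j` by `r j` over the `j` with
-- `0 < r j`. It is positive because a zero slack excludes `0 < r j`. The recursion compares the
-- quotient at the head with the minimum over the tail.
ratio-test : ∀ m (s r : Fin m → ℚ) → (∀ j → 0ℚ ≤ s j) → (∀ j → s j ≡ 0ℚ → r j ≤ 0ℚ) →
  (∃ λ j → 0ℚ < r j) →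
  ∃ λ α → 0ℚ < α × (∀ j → α * r j ≤ s j) × ∃ λ j → 0ℚ < r j × α * r j ≡ s j
ratio-test zero s r _ _ (() , _)
ratio-test (suc m) s r s≥0 s0 (j₀ , rj₀) with any? (λ j → 0ℚ <? r (suc j))
... | no none = headOnly j₀ rj₀
  where
  tail≤0 : ∀ j → r (suc j) ≤ 0ℚ
  tail≤0 j = ≮⇒≥ (λ p → none (j , p))
  headOnly : ∀ j₀ → 0ℚ < r j₀ → _
  headOnly (suc j) p = ⊥-elim (none (j , p))
  headOnly zero p with quotient⁺ p (≤∧≢⇒< (s≥0 zero) (λ e → <⇒≢ (<-≤-trans p (s0 zero (sym e))) refl))
  ... | α , α>0 , e = α , α>0 , bound , zero , p , e
    where
    bound : ∀ j → α * r j ≤ s j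
    bound zero = ≤-reflexive e
    bound (suc j) = ≤-trans (*-≤0 (<⇒≤ α>0) (tail≤0 j)) (s≥0 (suc j))
... | yes ex with ratio-test m (s ∘ suc) (r ∘ suc) (s≥0 ∘ suc) (s0 ∘ suc) ex
...   | α , α>0 , bound , j , rj , ej with α * r zero ≤? s zero
...     | yes ok = α , α>0 , (λ { zero → ok ; (suc j) → bound j }) , suc j , rj , ej
...     | no bad with 0ℚ <? r zero
...       | no r0 = ⊥-elim (bad (≤-trans (*-≤0 (<⇒≤ α>0) (≮⇒≥ r0)) (s≥0 zero)))
...       | yes r0 with quotient⁺ r0 (≤∧≢⇒< (s≥0 zero) (λ e → <⇒≢ (<-≤-trans r0 (s0 zero (sym e))) refl))
...         | β , β>0 , e = β , β>0 , bound' , zero , r0 , e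
  where
  β<α : β ≤ α
  β<α = <⇒≤ (*-cancelʳ-<-nonNeg (r zero) {{pos⇒nonNeg (r zero) {{positive r0}}}} (subst (_< α * r zero) (sym e) (≰⇒> bad)))
  bound' : ∀ j → β * r j ≤ s j
  bound' zero = ≤-reflexive e
  bound' (suc j) with 0ℚ ≤? r (suc j)
  ... | yes p = ≤-trans (*-monoʳ-≤-nonNeg (r (suc j)) {{nonNegative p}} β<α) (bound j)
  ... | no  p = ≤-trans (*-≤0 (<⇒≤ β>0) (<⇒≤ (≰⇒> p))) (s≥0 (suc j))

-- Functionals, affine independence and dimension

≈-sym : ∀ {N} {x y : Pt N} → x ≈ y → y ≈ x
≈-sym e i = sym (e i)

≈-trans : ∀ {N} {x y z : Pt N} → x ≈ y → y ≈ z → x ≈ z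
≈-trans e f i = trans (e i) (f i)

_⊝_ : ∀ {N} → Pt N → Pt N → Pt N
(x ⊝ y) i = x i - y i

comb : ∀ {N} k → (Fin k → ℚ) → (Fin k → Pt N) → Pt N
comb k c w j = sumF k (λ i → c i * w i j)

module _ {N : ℕ} (c : Pt N) where

  dot-cong : ∀ {x y} → x ≈ y → dot c x ≡ dot c y
  dot-cong e = sumF-cong N (λ i → cong (c i *_) (e i))

  dot-ray : ∀ y t g → dot c (y +[ t ]· g) ≡ dot c y + t * dot c g
  dot-ray y t g = trans (sumF-cong N (λ i → lem (c i) (y i) t (g i)))
    (trans (sumF-+ N (λ i → c i * y i) (λ i → t * (c i * g i)))
      (cong (dot c y +_) (sumF-* N t (λ i → c i * g i))))
    where lem : ∀ c y t g → c * (y + t * g) ≡ c * y + t * (c * g)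
          lem = solve-∀ ℚ-ring

  dot-scale : ∀ t g → dot c (λ i → t * g i) ≡ t * dot c g
  dot-scale t g = trans (sumF-cong N (λ i → lem (c i) t (g i))) (sumF-* N t (λ i → c i * g i))
    where lem : ∀ c t g → c * (t * g) ≡ t * (c * g)
          lem = solve-∀ ℚ-ring

  dot-neg : ∀ g → dot c (neg g) ≡ - dot c g
  dot-neg g = trans (dot-cong (λ i → lem (g i))) (trans (dot-scale (- 1ℚ) g) (sym (lem (dot c g))))
    where lem : ∀ g → - g ≡ (- 1ℚ) * g
          lem = solve-∀ ℚ-ring

  dot-⊝ : ∀ x y → dot c (x ⊝ y) ≡ dot c x - dot c y
  dot-⊝ x y = trans (dot-cong (λ i → lem (x i) (y i))) (trans (dot-ray x (- 1ℚ) y) (sym (lem (dot c x) (dot c y))))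
    where lem : ∀ x y → x - y ≡ x + (- 1ℚ) * y
          lem = solve-∀ ℚ-ring

  dot-comb : ∀ k (a : Fin k → ℚ) (w : Fin k → Pt N) →
    dot c (comb k a w) ≡ sumF k (λ i → a i * dot c (w i))
  dot-comb k a w =
    trans (sumF-cong N (λ j → sym (sumF-* k (c j) (λ i → a i * w i j))))
    (trans (sumF-swap N k (λ j i → c j * (a i * w i j)))
    (sumF-cong k (λ i → trans (sumF-cong N (λ j → lem (c j) (a i) (w i j))) (sumF-* N (a i) (λ j → c j * w i j)))))
    where lem : ∀ c t g → c * (t * g) ≡ t * (c * g)
          lem = solve-∀ ℚ-ring

  dot-0 : ∀ {x} → (∀ i → x i ≡ 0ℚ) → dot c x ≡ 0ℚ
  dot-0 z = sumF-0 N (λ i → trans (cong (c i *_) (z i)) (*-zeroʳ (c i)))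

dot-sumˡ : ∀ {N} m (C : Fin m → Pt N) x → dot (λ i → sumF m (λ j → C j i)) x ≡ sumF m (λ j → dot (C j) x)
dot-sumˡ {N} m C x = trans (sumF-cong N (λ i → trans (*-comm (sumF m (λ j → C j i)) (x i))
    (trans (sym (sumF-* m (x i) (λ j → C j i))) (sumF-cong m (λ j → *-comm (x i) (C j i))))))
  (sumF-swap N m (λ i j → C j i * x i))

-- A convex combination by iterated midpoints. All weights are positive, so the result is a relative
-- interior point of the hull: an inequality valid at all the points is tight here only if it is
-- tight at each of them (`blend-tight`).
blend : ∀ {N} k → (Fin (suc k) → Pt N) → Pt N
blend zero    p = p zero
blend (suc k) p = (λ i → ½ * p zero i) +[ ½ ]· blend k (p ∘ suc)

module _ {N : ℕ} (c : Pt N) (δ : ℚ) where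

  private
    dot-blend : ∀ k p → dot c (blend (suc k) p) ≡ ½ * dot c (p zero) + ½ * dot c (blend k (p ∘ suc))
    dot-blend k p = trans (dot-ray c (λ i → ½ * p zero i) ½ (blend k (p ∘ suc)))
      (cong (_+ ½ * dot c (blend k (p ∘ suc))) (dot-scale c ½ (p zero)))
    half : ∀ δ → δ ≡ ½ * δ + ½ * δ
    half = solve-∀ ℚ-ring
    lem : ∀ δ x y → δ - (½ * x + ½ * y) ≡ ½ * (δ - x) + ½ * (δ - y)
    lem = solve-∀ ℚ-ring

  blend-≡ : ∀ k p → (∀ i → dot c (p i) ≡ δ) → dot c (blend k p) ≡ δ
  blend-≡ zero    p e = e zero
  blend-≡ (suc k) p e = trans (dot-blend k p)
    (trans (cong₂ (λ x y → ½ * x + ½ * y) (e zero) (blend-≡ k (p ∘ suc) (e ∘ suc))) (sym (half δ)))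

  blend-≤ : ∀ k p → (∀ i → dot c (p i) ≤ δ) → dot c (blend k p) ≤ δ
  blend-≤ zero    p e = e zero
  blend-≤ (suc k) p e = ≤-by
    (0≤+ (0≤* (<⇒≤ 0<½) (≤⇒0≤∸ (e zero))) (0≤* (<⇒≤ 0<½) (≤⇒0≤∸ (blend-≤ k (p ∘ suc) (e ∘ suc)))))
    (trans (cong (λ t → δ - t) (dot-blend k p)) (lem δ (dot c (p zero)) (dot c (blend k (p ∘ suc)))))

  blend-tight : ∀ k p → (∀ i → dot c (p i) ≤ δ) → dot c (blend k p) ≡ δ → ∀ i → dot c (p i) ≡ δ
  blend-tight zero    p e t zero = t
  blend-tight (suc k) p e t = λ { zero → here ; (suc i) → there i }
    where
    x y : ℚ
    x = dot c (p zero)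
    y = dot c (blend k (p ∘ suc))
    sum0 : ½ * (δ - x) + ½ * (δ - y) ≡ 0ℚ
    sum0 = trans (sym (lem δ x y)) (trans (cong (λ t → δ - t) (trans (sym (dot-blend k p)) t)) (+-inverseʳ δ))
    sx : 0ℚ ≤ ½ * (δ - x)
    sx = 0≤* (<⇒≤ 0<½) (≤⇒0≤∸ (e zero))
    sy : 0ℚ ≤ ½ * (δ - y)
    sy = 0≤* (<⇒≤ 0<½) (≤⇒0≤∸ (blend-≤ k (p ∘ suc) (e ∘ suc)))
    zx : ½ * (δ - x) ≡ 0ℚ
    zx = ≤-antisym (subst₂ _≤_ (+-identityʳ _) sum0 (+-monoʳ-≤ (½ * (δ - x)) sy)) sx
    zy : ½ * (δ - y) ≡ 0ℚ
    zy = ≤-antisym (subst₂ _≤_ (+-identityˡ _) sum0 (+-monoˡ-≤ (½ * (δ - y)) sx)) sy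
    here : x ≡ δ
    here = sym (≡-by (*-cancel-0 (pos⇒≢0 0<½) zx) refl)
    there : ∀ i → dot c (p (suc i)) ≡ δ
    there = blend-tight k (p ∘ suc) (e ∘ suc) (sym (≡-by (*-cancel-0 (pos⇒≢0 0<½) zy) refl))

LinIndep-cong : ∀ {N} k {v w : Fin k → Pt N} → (∀ i → v i ≈ w i) → LinIndep k v → LinIndep k w
LinIndep-cong k e ind c z = ind c (λ j → trans (sumF-cong k (λ i → cong (c i *_) (e i j))) (z j))

LinIndep-tail : ∀ {N} k {w : Fin (suc k) → Pt N} → LinIndep (suc k) w → LinIndep k (w ∘ suc)
LinIndep-tail k {w} ind c z i = ind (0ℚ ∷ c) (λ j → trans (cong (_+ sumF k (λ i → c i * w (suc i) j)) (*-zeroˡ (w zero j)))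
  (trans (+-identityˡ _) (z j))) (suc i)

-- Applying `c` to a relation isolates the coefficient of `z`, which must vanish; the rest is a
-- relation among `w`.
LinIndep-cons : ∀ {N} k (z : Pt N) (w : Fin k → Pt N) (c : Pt N) →
  (∀ i → dot c (w i) ≡ 0ℚ) → dot c z ≢ 0ℚ → LinIndep k w → LinIndep (suc k) (z ∷ w)
LinIndep-cons k z w c cw cz ind a e = all0
  where
  a0 : a zero ≡ 0ℚ
  a0 = *-cancel-0 cz (begin
    dot c z * a zero ≡⟨ *-comm (dot c z) (a zero) ⟩
    a zero * dot c z ≡⟨ +-identityʳ _ ⟨
    a zero * dot c z + 0ℚ ≡⟨ cong (a zero * dot c z +_) (sumF-0 k (λ i → trans (cong (a (suc i) *_) (cw i)) (*-zeroʳ (a (suc i))))) ⟨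
    sumF (suc k) (λ i → a i * dot c ((z ∷ w) i)) ≡⟨ dot-comb c (suc k) a (z ∷ w) ⟨
    dot c (comb (suc k) a (z ∷ w)) ≡⟨ dot-0 c e ⟩
    0ℚ ∎)
    where open ≡-Reasoning
  all0 : ∀ i → a i ≡ 0ℚ
  all0 zero    = a0
  all0 (suc i) = ind (a ∘ suc) (λ j → trans (sym (trans (cong (_+ comb k (a ∘ suc) w j)
    (trans (cong (_* z j) a0) (*-zeroˡ (z j)))) (+-identityˡ _))) (e j)) i

LinIndep-scale : ∀ {N} k (w : Fin k → Pt N) (ε : Fin k → ℚ) → (∀ i → ε i ≢ 0ℚ) →
  LinIndep k w → LinIndep k (λ i j → ε i * w i j)
LinIndep-scale k w ε ε≢0 ind c z i = *-cancel-0 (ε≢0 i) (trans (*-comm (ε i) (c i))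
  (ind (λ i → c i * ε i) (λ j → trans (sumF-cong k (λ i → *-assoc (c i) (ε i) (w i j))) (z j)) i))

-- The new point goes second, so the base point and the old differences are untouched. The
-- functional `c` vanishes on the old differences but not on the new one.
AffIndep-insert : ∀ {N} k (p : Fin (suc k) → Pt N) x c r → AffIndep k p →
  (∀ i → dot c (p i) ≡ r) → dot c x ≢ r → AffIndep (suc k) (p zero ∷ x ∷ (λ i → p (suc i)))
AffIndep-insert k p x c r ind e ne =
  LinIndep-cong (suc k) {(x ⊝ p zero) ∷ (λ i → p (suc i) ⊝ p zero)} {λ i → (p zero ∷ x ∷ (λ i → p (suc i))) (suc i) ⊝ p zero}
    (λ { zero j → refl ; (suc i) j → refl })
    (LinIndep-cons k (x ⊝ p zero) (λ i → p (suc i) ⊝ p zero) c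
      (λ i → trans (dot-⊝ c (p (suc i)) (p zero)) (trans (cong₂ _-_ (e (suc i)) (e zero)) (+-inverseʳ r)))
      (λ z → ne (trans (≡-by z (sym (dot-⊝ c x (p zero)))) (e zero))) ind)

Points : ∀ {N} → PSet N → ℕ → Set
Points {N} F k = ∃ λ (p : Fin (suc k) → Pt N) → (∀ i → F (p i)) × AffIndep k p

module _ {N : ℕ} (F : PSet N) where

  Points-pred : ∀ k → Points F (suc k) → Points F k
  Points-pred k (p , pF , ind) = (p zero ∷ (λ i → p (suc (suc i)))) ,
    (λ { zero → pF zero ; (suc i) → pF (suc (suc i)) }) ,
    LinIndep-tail k {λ i → p (suc i) ⊝ p zero} ind

  Points-≤ : ∀ {k l} → k ℕ.≤′ l → Points F l → Points F k
  Points-≤ ℕ.≤′-refl     P = P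
  Points-≤ (ℕ.≤′-step q) P = Points-≤ q (Points-pred _ P)

  HasDim-unique : ∀ k l → HasDim F k → HasDim F l → k ≡ l
  HasDim-unique k l (P , nP) (Q , nQ) with ℕₚ.<-cmp k l
  ... | tri< k<l _ _ = ⊥-elim (nP (Points-≤ (ℕₚ.≤⇒≤′ k<l) Q))
  ... | tri≈ _ k≡l _ = k≡l
  ... | tri> _ _ l<k = ⊥-elim (nQ (Points-≤ (ℕₚ.≤⇒≤′ l<k) P))

SameSet-sym : ∀ {N} {F G : PSet N} → SameSet F G → SameSet G F
SameSet-sym e x = proj₂ (e x) , proj₁ (e x)

SameSet-trans : ∀ {N} {F G H : PSet N} → SameSet F G → SameSet G H → SameSet F H
SameSet-trans e f x = proj₁ (f x) ∘ proj₁ (e x) , proj₂ (e x) ∘ proj₂ (f x)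

-- Faces and vertices of a system of inequalities

module Constraints {N : ℕ} (S : System N) where
  open System S

  row : Fin m₂ → Pt N → ℚ
  row j = dot (B j)

  Tight : Pt N → Fin m₂ → Set
  Tight x j = row j x ≡ d j

  tight? : ∀ x j → Dec (Tight x j)
  tight? x j = row j x ≟ d j

  RowFace : Fin m₂ → PSet N
  RowFace j x = InP S x × row j x ≡ d j

  -- The cone of feasible directions, expressed by rows instead of a step length; for `y` in the
  -- polytope, `nudge` and `in-cone` show the two descriptions to agree.
  Feasible : Pt N → Pt N → Set
  Feasible y g = InKer S g × (∀ j → Tight y j → row j g ≤ 0ℚ)

  InP-cong : ∀ {x y} → x ≈ y → InP S x → InP S y
  InP-cong e (pA , pB) = (λ i → trans (sym (dot-cong (A i) e)) (pA i)) ,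
                         (λ j → subst (_≤ d j) (dot-cong (B j) e) (pB j))

  slack≥0 : ∀ {x} → InP S x → ∀ j → 0ℚ ≤ d j - row j x
  slack≥0 p j = ≤⇒0≤∸ (proj₂ p j)

  slack>0 : ∀ {x} → InP S x → ∀ j → ¬ Tight x j → 0ℚ < d j - row j x
  slack>0 p j n = <⇒0<∸ (≤∧≢⇒< (proj₂ p j) n)

  row-ray : ∀ {y} t g j → row j y + t * row j g ≡ row j (y +[ t ]· g)
  row-ray {y} t g j = sym (dot-ray (B j) y t g)

  ker-⊝ : ∀ {x y} → InP S x → InP S y → InKer S (x ⊝ y)
  ker-⊝ {x} {y} p q i = trans (dot-⊝ (A i) x y) (trans (cong₂ _-_ (proj₁ p i) (proj₁ q i)) (+-inverseʳ (b i)))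

  ker-scale : ∀ t {g} → InKer S g → InKer S (λ i → t * g i)
  ker-scale t {g} k i = trans (dot-scale (A i) t g) (trans (cong (t *_) (k i)) (*-zeroʳ t))

  ker-ray : ∀ {y} t {g} → InKer S y → InKer S g → InKer S (y +[ t ]· g)
  ker-ray {y} t {g} k l i = trans (dot-ray (A i) y t g) (trans (cong₂ _+_ (k i) (trans (cong (t *_) (l i)) (*-zeroʳ t))) refl)

  ker-neg : ∀ {g} → InKer S g → InKer S (neg g)
  ker-neg {g} k i = trans (dot-neg (A i) g) (cong -_ (k i))

  ker-comb : ∀ k (c : Fin k → ℚ) (w : Fin k → Pt N) → (∀ i → InKer S (w i)) → InKer S (comb k c w)
  ker-comb k c w kw i = trans (dot-comb (A i) k c w) (sumF-0 k (λ s → trans (cong (c s *_) (kw s i)) (*-zeroʳ (c s))))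

  ray-InP : ∀ {y} t {g} → InP S y → InKer S g → (∀ j → t * row j g ≤ d j - row j y) → InP S (y +[ t ]· g)
  ray-InP {y} t {g} p k le =
    (λ i → trans (dot-ray (A i) y t g) (trans (cong₂ _+_ (proj₁ p i) (trans (cong (t *_) (k i)) (*-zeroʳ t))) (+-identityʳ (b i)))) ,
    (λ j → subst (_≤ d j) (row-ray t g j) (≤-by (≤⇒0≤∸ (le j)) (lem (d j) (row j y) (t * row j g))))
    where lem : ∀ d y t → d - (y + t) ≡ (d - y) - t
          lem = solve-∀ ℚ-ring

  ray-tight : ∀ {y} t {g} j → t * row j g ≡ d j - row j y → Tight (y +[ t ]· g) j
  ray-tight {y} t {g} j e = trans (sym (row-ray t g j)) (trans (cong (row j y +_) e) (lem (row j y) (d j)))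
    where lem : ∀ y d → y + (d - y) ≡ d
          lem = solve-∀ ℚ-ring

  max-step : ∀ {y g} → InP S y → Feasible y g → (∃ λ j → 0ℚ < row j g) →
    ∃ λ α → 0ℚ < α × InP S (y +[ α ]· g) × ∃ λ j → 0ℚ < row j g × Tight (y +[ α ]· g) j
  max-step {y} {g} p (k , f) ex = fin (ratio-test m₂ (λ j → d j - row j y) (λ j → row j g) (slack≥0 p)
      (λ j e → f j (sym (≡-by e refl))) ex)
    where
    fin : _ → _
    fin (α , α>0 , le , j , rj , e) = α , α>0 , ray-InP α p k le , j , rj , ray-tight α j e

  nudge : ∀ {y g} → InP S y → Feasible y g → ∃ λ ε → 0ℚ < ε × InP S (y +[ ε ]· g)
  nudge {y} {g} p f with any? (λ j → 0ℚ <? row j g)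
  ... | yes ex = let α , α>0 , q , _ = max-step p f ex in α , α>0 , q
  ... | no none = 1ℚ , 0<1 , ray-InP 1ℚ p (proj₁ f) λ j →
        ≤-trans (subst (_≤ 0ℚ) (sym (*-identityˡ (row j g))) (≮⇒≥ (λ l → none (j , l)))) (slack≥0 p j)

  in-cone : ∀ {y ε g} → InP S y → 0ℚ < ε → InP S (y +[ ε ]· g) → Feasible y g
  in-cone {y} {ε} {g} p ε>0 q =
    (λ i → *-cancel-0 (pos⇒≢0 ε>0) (trans (lem (dot (A i) y) ε (dot (A i) g))
       (trans (cong₂ _-_ (trans (sym (dot-ray (A i) y ε g)) (proj₁ q i)) (proj₁ p i)) (+-inverseʳ (b i))))) ,
    (λ j t → 0≤-⁻¹ (0≤-cancel ε>0 (subst (0ℚ ≤_)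
       (trans (cong₂ _-_ (sym t) (sym (row-ray ε g j))) (lem' (row j y) ε (row j g))) (slack≥0 q j))))
    where
    lem : ∀ y ε g → ε * g ≡ y + ε * g - y
    lem = solve-∀ ℚ-ring
    lem' : ∀ y ε g → y - (y + ε * g) ≡ ε * - g
    lem' = solve-∀ ℚ-ring

  faceOf : (Fin m₂ → Set) → PSet N
  faceOf Q x = InP S x × (∀ j → Q j → Tight x j)

  Face-resp : ∀ {F G} → SameSet F G → Face S F → Face S G
  Face-resp e (c , δ , val , same , x , Fx) =
    c , δ , val , SameSet-trans (SameSet-sym e) same , x , proj₁ (e x) Fx

  -- The sum of the rows in `Q` supports this face: each row is bounded by its right-hand side, so
  -- equality of the sums forces equality in every term.
  faceOf-Face : ∀ Q → (∀ j → Dec (Q j)) → (∃ (faceOf Q)) → Face S (faceOf Q)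
  faceOf-Face Q Q? ne = (λ i → sumF m₂ (λ j → C j i)) , sumF m₂ D , valid , same , ne
    where
    pick : ∀ {j} → Dec (Q j) → ℚ → ℚ
    pick (yes _) t = t
    pick (no _)  t = 0ℚ
    C : Fin m₂ → Pt N
    C j i = pick (Q? j) (B j i)
    D : Fin m₂ → ℚ
    D j = pick (Q? j) (d j)
    dotC : ∀ j x (q : Dec (Q j)) → dot (λ i → pick q (B j i)) x ≡ pick q (row j x)
    dotC j x (yes _) = refl
    dotC j x (no _)  = sumF-0 N (λ i → *-zeroˡ (x i))
    total : ∀ x → dot (λ i → sumF m₂ (λ j → C j i)) x ≡ sumF m₂ (λ j → pick (Q? j) (row j x))
    total x = trans (dot-sumˡ m₂ C x) (sumF-cong m₂ (λ j → dotC j x (Q? j)))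
    term : ∀ x → InP S x → ∀ j (q : Dec (Q j)) → pick q (row j x) ≤ pick q (d j)
    term x p j (yes _) = proj₂ p j
    term x p j (no _)  = ≤-refl
    valid : ∀ x → InP S x → dot (λ i → sumF m₂ (λ j → C j i)) x ≤ sumF m₂ D
    valid x p = subst (_≤ sumF m₂ D) (sym (total x)) (sumF-mono m₂ (λ j → term x p j (Q? j)))
    eqs : ∀ x → (∀ j → Q j → Tight x j) → ∀ j (q : Dec (Q j)) → pick q (row j x) ≡ pick q (d j)
    eqs x t j (yes q) = t j q
    eqs x t j (no _)  = refl
    sumeq : ∀ m (f g : Fin m → ℚ) → (∀ j → f j ≤ g j) → sumF m f ≡ sumF m g → ∀ j → f j ≡ g j
    sumeq m f g le e j = sym (≡-by (≤-antisym (subst (g j - f j ≤_) zero' (sumF-term≤ m (λ j → ≤⇒0≤∸ (le j)) j))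
                                       (≤⇒0≤∸ (le j))) refl)
      where
      lem : ∀ x → - x ≡ - 1ℚ * x
      lem = solve-∀ ℚ-ring
      zero' : sumF m (λ j → g j - f j) ≡ 0ℚ
      zero' = trans (sumF-+ m g (λ j → - f j)) (trans (cong (sumF m g +_)
        (trans (sumF-cong m (λ j → lem (f j))) (trans (sumF-* m (- 1ℚ) f) (sym (lem (sumF m f))))))
        (trans (cong (λ t → sumF m g - t) e) (+-inverseʳ (sumF m g))))
    use : ∀ x j (q : Dec (Q j)) → pick q (row j x) ≡ pick q (d j) → Q j → Tight x j
    use x j (yes _) e _ = e
    use x j (no n)  e q = ⊥-elim (n q)
    same : SameSet (faceOf Q) (λ x → InP S x × dot (λ i → sumF m₂ (λ j → C j i)) x ≡ sumF m₂ D)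
    same x = (λ { (p , t) → p , trans (total x) (sumF-cong m₂ (λ j → eqs x t j (Q? j))) }) ,
             (λ { (p , e) → p , λ j q → use x j (Q? j) (sumeq m₂ (λ j → pick (Q? j) (row j x)) D
                     (λ j → term x p j (Q? j)) (trans (sym (total x)) e) j) q })

  Face-⊆ : ∀ {F} → Face S F → ∀ {x} → F x → InP S x
  Face-⊆ (_ , _ , _ , same , _) {x} Fx = proj₁ (proj₁ (same x) Fx)

  Face-cong : ∀ {F} → Face S F → ∀ {x y} → x ≈ y → F x → F y
  Face-cong (c , δ , val , same , _) {x} {y} e Fx = let p , t = proj₁ (same x) Fx in
    proj₂ (same y) (InP-cong e p , trans (sym (dot-cong c e)) t)

  Vertex-InP : ∀ {v} → Vertex S v → InP S v
  Vertex-InP V = Face-⊆ V (λ _ → refl)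

  Vertex-cong : ∀ {u v} → u ≈ v → Vertex S u → Vertex S v
  Vertex-cong e = Face-resp (λ x → (λ a → ≈-trans a e) , (λ a → ≈-trans a (≈-sym e)))

  -- The rank criterion for a vertex, phrased as triviality of a kernel.
  Rigid : Pt N → Set
  Rigid u = ∀ z → InKer S z → (∀ j → Tight u j → row j z ≡ 0ℚ) → ∀ i → z i ≡ 0ℚ

  face-value-≤ : ∀ {c δ u g} → (∀ x → InP S x → dot c x ≤ δ) → InP S u → dot c u ≡ δ → Feasible u g → dot c g ≤ 0ℚ
  face-value-≤ {c} {δ} {u} {g} val p e f with nudge p f
  ... | ε , ε>0 , q = 0≤-⁻¹ (0≤-cancel ε>0 (subst (0ℚ ≤_)
    (trans (cong₂ _-_ (sym e) (dot-ray c u ε g)) (lem (dot c u) ε (dot c g))) (≤⇒0≤∸ (val _ q))))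
    where lem : ∀ u ε g → u - (u + ε * g) ≡ ε * - g
          lem = solve-∀ ℚ-ring

  Feasible-neg : ∀ {u z} → InKer S z → (∀ j → Tight u j → row j z ≡ 0ℚ) → Feasible u (neg z)
  Feasible-neg {u} {z} k t = ker-neg k , λ j tj → ≤-reflexive (trans (dot-neg (B j) z) (cong -_ (t j tj)))

  -- Both `z` and `neg z` are feasible at `u`, and a functional that attains its maximum at `u`
  -- cannot increase along either.
  face-value-≡ : ∀ {c δ u z} → (∀ x → InP S x → dot c x ≤ δ) → InP S u → dot c u ≡ δ →
    InKer S z → (∀ j → Tight u j → row j z ≡ 0ℚ) → dot c z ≡ 0ℚ
  face-value-≡ {c} {δ} {u} {z} val p e k t = ≤-antisym
    (face-value-≤ {c} val p e (k , λ j tj → ≤-reflexive (t j tj)))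
    (subst (0ℚ ≤_) (trans (cong -_ (dot-neg c z)) (neg-neg (dot c z))) (0≤- (face-value-≤ {c} val p e (Feasible-neg k t))))

  Vertex⇒Rigid : ∀ {u} → Vertex S u → Rigid u
  Vertex⇒Rigid {u} V@(c , δ , val , same , _) z k t i with nudge (Vertex-InP V) (k , λ j tj → ≤-reflexive (t j tj))
  ... | ε , ε>0 , q = *-cancel-0 (pos⇒≢0 ε>0) (trans (lem (u i) (ε * z i))
      (trans (cong (_- u i) (proj₂ (same (u +[ ε ]· z)) (q , val') i)) (+-inverseʳ (u i))))
    where
    p = Vertex-InP V
    cu : dot c u ≡ δ
    cu = proj₂ (proj₁ (same u) (λ _ → refl))
    val' : dot c (u +[ ε ]· z) ≡ δ
    val' = trans (dot-ray c u ε z) (trans (cong₂ _+_ cu (trans (cong (ε *_) (face-value-≡ {c} val p cu k t)) (*-zeroʳ ε))) (+-identityʳ δ))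
    lem : ∀ u e → e ≡ u + e - u
    lem = solve-∀ ℚ-ring

  Rigid⇒Vertex : ∀ {u} → InP S u → Rigid u → Vertex S u
  Rigid⇒Vertex {u} p rigid = Face-resp same (faceOf-Face (Tight u) (tight? u) (u , p , λ j t → t))
    where
    same : SameSet (faceOf (Tight u)) (λ x → x ≈ u)
    same x = (λ { (q , t) i → ≡-by (rigid (x ⊝ u) (ker-⊝ q p)
                 (λ j tj → trans (dot-⊝ (B j) x u) (trans (cong₂ _-_ (t j tj) tj) (+-inverseʳ (d j)))) i) refl }) ,
             (λ e → InP-cong (≈-sym e) p , λ j tj → trans (dot-cong (B j) e) tj)

  common : Pt N → Pt N → Fin m₂ → Set
  common u v j = Tight u j × Tight v j

  common? : ∀ u v j → Dec (common u v j)
  common? u v j = tight? u j ×-dec tight? v j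

  -- The midpoint `m` of `u` and `v` is tight only in the common rows. The functional of any face
  -- through `u` and `v` is maximal at `m`, hence constant along `x ⊝ m`, on which all these rows
  -- vanish.
  minFace : ∀ {u v} → InP S u → InP S v → MinFace S u v (faceOf (common u v))
  minFace {u} {v} pu pv = faceOf-Face (common u v) (common? u v) (u , Fu) , Fu , (pv , λ j → proj₂) , least
    where
    Fu : faceOf (common u v) u
    Fu = pu , λ j → proj₁
    uv : Fin 2 → Pt N
    uv = u ∷ v ∷ λ ()
    m : Pt N
    m = blend 1 uv
    pm : InP S m
    pm = (λ i → blend-≡ (A i) (b i) 1 uv (λ { zero → proj₁ pu i ; (suc zero) → proj₁ pv i })) ,
         (λ j → blend-≤ (B j) (d j) 1 uv (λ { zero → proj₂ pu j ; (suc zero) → proj₂ pv j }))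
    least : ∀ G → Face S G → G u → G v → ∀ x → faceOf (common u v) x → G x
    least G (c , δ , val , same , _) Gu Gv x (px , tx) = proj₂ (same x) (px ,
        trans (≡-by cz (sym (dot-⊝ c x m))) cm)
      where
      cm : dot c m ≡ δ
      cm = blend-≡ c δ 1 uv (λ { zero → proj₂ (proj₁ (same u) Gu) ; (suc zero) → proj₂ (proj₁ (same v) Gv) })
      tm : ∀ j → Tight m j → row j (x ⊝ m) ≡ 0ℚ
      tm j t = trans (dot-⊝ (B j) x m) (trans (cong₂ _-_ (tx j (both zero , both (suc zero))) t) (+-inverseʳ (d j)))
        where
        both : ∀ i → dot (B j) (uv i) ≡ d j
        both = blend-tight (B j) (d j) 1 uv (λ { zero → proj₂ pu j ; (suc zero) → proj₂ pv j }) t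
      cz : dot c (x ⊝ m) ≡ 0ℚ
      cz = face-value-≡ {c} val pm cm (ker-⊝ px pm) tm

-- Polytopes in minimal representation

overshoot : ∀ M y s → (- M) ≤ y → y + s ≤ M → s ≡ M + M + 1ℚ → ⊥
overshoot M y s lo hi e = <-irrefl refl (<-≤-trans 0<1 (≤-by {1ℚ} {0ℚ} (0≤+ (≤⇒0≤∸ lo) (≤⇒0≤∸ hi))
    (trans (lem M y) (cong (λ s → (y - (- M)) + (M - (y + s))) (sym e)))))
  where
  lem : ∀ M y → 0ℚ - 1ℚ ≡ (y - (- M)) + (M - (y + (M + M + 1ℚ)))
  lem = solve-∀ ℚ-ring

-- The step is scaled to move `y` by `M + M + 1ℚ`, more than the width of the interval that should
-- contain it. A negative `g` is treated by reflecting at the origin.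
unbounded : ∀ M y g → g ≢ 0ℚ → (- M) ≤ y → y ≤ M →
  (∀ t → 0ℚ < t → (- M) ≤ y + t * g) → (∀ t → 0ℚ < t → y + t * g ≤ M) → ⊥
unbounded M y g g≢0 lo hi los his = by-sign (<-cmp 0ℚ g)
  where
  width : 0ℚ < M + M + 1ℚ
  width = <-by (0<+ 0<1 (0≤+ (≤⇒0≤∸ lo) (≤⇒0≤∸ hi))) (lem M y)
    where lem : ∀ M y → M + M + 1ℚ - 0ℚ ≡ 1ℚ + ((y - (- M)) + (M - y))
          lem = solve-∀ ℚ-ring
  up : 0ℚ < g → (∃ λ c → 0ℚ < c × c * g ≡ M + M + 1ℚ) → ⊥
  up _ (t , t>0 , e) = overshoot M y (t * g) lo (his t t>0) e
  down : g < 0ℚ → (∃ λ c → 0ℚ < c × c * - g ≡ M + M + 1ℚ) → ⊥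
  down _ (t , t>0 , e) = overshoot M (- y) (t * - g) (neg-antimono-≤ hi)
    (subst₂ _≤_ (lem₁ y t g) (lem₂ M) (neg-antimono-≤ (los t t>0))) e
    where lem₁ : ∀ y t g → - (y + t * g) ≡ - y + t * - g
          lem₁ = solve-∀ ℚ-ring
          lem₂ : ∀ M → - - M ≡ M
          lem₂ = solve-∀ ℚ-ring
  by-sign : _ → ⊥
  by-sign (tri≈ _ e _) = g≢0 (sym e)
  by-sign (tri< g>0 _ _) = up g>0 (quotient⁺ g>0 width)
  by-sign (tri> _ _ g<0) = down g<0 (quotient⁺ (0<- g<0) width)

module Polytope {N : ℕ} (S : System N) (n' : ℕ) (bounded : Bounded S)
                (dimP : HasDim (InP S) (suc n')) (minimal : MinimalRep S) where
  open System S
  open Constraints S public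

  n : ℕ
  n = suc n'

  -- If no row rose along `g`, the whole ray from `y` would stay in the polytope, against
  -- boundedness.
  ascent : ∀ {y g} → InP S y → InKer S g → (∃ λ i → g i ≢ 0ℚ) → ∃ λ j → 0ℚ < row j g
  ascent {y} {g} p k (i , gi≢0) with any? (λ j → 0ℚ <? row j g)
  ... | yes ex = ex
  ... | no none = ⊥-elim (unbounded (proj₁ bounded) (y i) (g i) gi≢0
      (proj₁ (proj₂ bounded y p i)) (proj₂ (proj₂ bounded y p i))
      (λ t t>0 → proj₁ (proj₂ bounded (y +[ t ]· g) (ray t t>0) i))
      (λ t t>0 → proj₂ (proj₂ bounded (y +[ t ]· g) (ray t t>0) i)))
    where
    ray : ∀ t → 0ℚ < t → InP S (y +[ t ]· g)
    ray t t>0 = ray-InP t p k (λ j → ≤-trans (*-≤0 (<⇒≤ t>0) (≮⇒≥ (λ l → none (j , l)))) (slack≥0 p j))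

  nonZero-at : ∀ {g : Pt N} → ¬ (∀ i → g i ≡ 0ℚ) → ∃ λ i → g i ≢ 0ℚ
  nonZero-at {g} nz with any? (λ i → ¬? (g i ≟ 0ℚ))
  ... | yes ex = ex
  ... | no none = ⊥-elim (nz (λ i → decidable-stable (g i ≟ 0ℚ) (λ ne → none (i , ne))))

  basePts : Fin (suc n) → Pt N
  basePts = proj₁ (proj₁ dimP)

  facetDim : ∀ j → HasDim (RowFace j) n'
  facetDim j with minimal j
  ... | _ , k , dP , dF = subst (HasDim (RowFace j)) (ℕₚ.suc-injective (HasDim-unique (InP S) (suc k) n dP dimP)) dF

  facetPts : ∀ j → Fin n → Pt N
  facetPts j = proj₁ (proj₁ (facetDim j))

  facetPts-in : ∀ j i → RowFace j (facetPts j i)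
  facetPts-in j = proj₁ (proj₂ (proj₁ (facetDim j)))

  facetPts-ind : ∀ j → AffIndep n' (facetPts j)
  facetPts-ind j = proj₂ (proj₂ (proj₁ (facetDim j)))

  blend-InP : ∀ k (p : Fin (suc k) → Pt N) → (∀ i → InP S (p i)) → InP S (blend k p)
  blend-InP k p pin = (λ i → blend-≡ (A i) (b i) k p (λ s → proj₁ (pin s) i)) ,
                      (λ j → blend-≤ (B j) (d j) k p (λ s → proj₂ (pin s) j))

  centre : Pt N
  centre = blend n basePts

  centre-InP : InP S centre
  centre-InP = blend-InP n basePts (proj₁ (proj₂ (proj₁ dimP)))

  -- A row tight at the blend is tight at all base points, and its facet would then have the
  -- dimension of the whole polytope.
  centre-interior : ∀ j → ¬ Tight centre j
  centre-interior j t = proj₂ (facetDim j) (basePts ,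
    (λ i → proj₁ (proj₂ (proj₁ dimP)) i , blend-tight (B j) (d j) n basePts (λ s → proj₂ (proj₁ (proj₂ (proj₁ dimP)) s) j) t i) ,
    proj₂ (proj₂ (proj₁ dimP)))

  -- From the interior point `centre` one can move a little in every kernel direction, so
  -- independent kernel vectors yield affinely independent points of the polytope.
  ker-dim : ∀ (w : Fin (suc n) → Pt N) → (∀ i → InKer S (w i)) → ¬ LinIndep (suc n) w
  ker-dim w kw ind = proj₂ dimP ((centre ∷ (λ i → centre +[ ε i ]· w i)) ,
      (λ { zero → centre-InP ; (suc i) → proj₂ (proj₂ (push i)) }) ,
      LinIndep-cong (suc n) {λ i j → ε i * w i j} (λ i j → lem (centre j) (ε i * w i j))
        (LinIndep-scale (suc n) w ε (λ i → pos⇒≢0 (proj₁ (proj₂ (push i)))) ind))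
    where
    push : ∀ i → ∃ λ ε → 0ℚ < ε × InP S (centre +[ ε ]· w i)
    push i = nudge centre-InP (kw i , λ j t → ⊥-elim (centre-interior j t))
    ε : Fin (suc n) → ℚ
    ε i = proj₁ (push i)
    lem : ∀ c e → e ≡ c + e - c
    lem = solve-∀ ℚ-ring

  -- The points `p` already span a section that has no `n + 1` affinely independent points; a point
  -- of it with another value of `c` would extend them. Applied in both directions, this identifies
  -- facets that share such points.
  section-⊆ : ∀ (p : Fin n → Pt N) c c' δ δ' → (∀ i → InP S (p i)) → AffIndep n' p →
    (∀ i → dot c (p i) ≡ δ) → (∀ i → dot c' (p i) ≡ δ') →
    ¬ Points (λ x → InP S x × dot c' x ≡ δ') n → ∀ x → InP S x → dot c' x ≡ δ' → dot c x ≡ δ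
  section-⊆ p c c' δ δ' pin ind e e' none x px ex = decidable-stable (dot c x ≟ δ) λ ne →
    none ((p zero ∷ x ∷ (λ i → p (suc i))) ,
          (λ { zero → pin zero , e' zero ; (suc zero) → px , ex ; (suc (suc i)) → pin (suc i) , e' (suc i) }) ,
          AffIndep-insert n' p x c δ ind e ne)

  -- MinimalRep does not exclude several rows defining the same facet.
  infix 4 _~_

  _~_ : Fin m₂ → Fin m₂ → Set
  j ~ l = SameSet (RowFace j) (RowFace l)

  ~-refl : ∀ {j} → j ~ j
  ~-refl x = id , id

  ~-sym : ∀ {j l} → j ~ l → l ~ j
  ~-sym = SameSet-sym

  ~-trans : ∀ {j l k} → j ~ l → l ~ k → j ~ k
  ~-trans = SameSet-trans

  ~-tight : ∀ {j l x} → j ~ l → InP S x → Tight x j → Tight x l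
  ~-tight e p t = proj₂ (proj₁ (e _) (p , t))

  same-points : ∀ j l → (∀ i → Tight (facetPts j i) l) → j ~ l
  same-points j l t x =
    (λ { (p , e) → p , section-⊆ (facetPts j) (B l) (B j) (d l) (d j) pin ind t tj (proj₂ (facetDim j)) x p e }) ,
    (λ { (p , e) → p , section-⊆ (facetPts j) (B j) (B l) (d j) (d l) pin ind tj t (proj₂ (facetDim l)) x p e })
    where
    pin = λ i → proj₁ (facetPts-in j i)
    tj = λ i → proj₂ (facetPts-in j i)
    ind = facetPts-ind j

  -- Testing row `l` on the spanning points of facet `j` decides `~`, and a failed test keeps the
  -- witness that separates the facets.
  compare : ∀ j l → j ~ l ⊎ ∃ λ p → RowFace j p × ¬ Tight p l
  compare j l with any? (λ i → ¬? (tight? (facetPts j i) l))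
  ... | yes (i , nt) = inj₂ (facetPts j i , facetPts-in j i , nt)
  ... | no none = inj₁ (same-points j l (λ i → decidable-stable (tight? (facetPts j i) l) (λ nt → none (i , nt))))

  _~?_ : ∀ j l → Dec (j ~ l)
  j ~? l with compare j l
  ... | inj₁ s = yes s
  ... | inj₂ (p , (pin , t) , nt) = no (λ s → nt (~-tight s pin t))

  -- Otherwise the kernel would be too large. The differences `base` within the facet vanish under
  -- both rows, row `l` separates `z` from them, and row `j` separates `inward` from all of these:
  -- `n + 1` independent vectors.
  ~-kernel : ∀ {j l} → j ~ l → ∀ z → InKer S z → row j z ≡ 0ℚ → row l z ≡ 0ℚ
  ~-kernel {j} {l} j~l z kz jz = decidable-stable (row l z ≟ 0ℚ) λ lz →
    ker-dim (inward ∷ z ∷ base)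
      (λ { zero → ker-⊝ centre-InP (pin zero) ; (suc zero) → kz ; (suc (suc i)) → ker-⊝ (pin (suc i)) (pin zero) })
      (LinIndep-cons n inward (z ∷ base) (B j)
        (λ { zero → jz ; (suc i) → flat j tj i }) inward≢0
        (LinIndep-cons n' z base (B l) (flat l tl) lz (facetPts-ind j)))
    where
    pin = λ i → proj₁ (facetPts-in j i)
    tj : ∀ i → Tight (facetPts j i) j
    tj i = proj₂ (facetPts-in j i)
    tl : ∀ i → Tight (facetPts j i) l
    tl i = ~-tight j~l (pin i) (tj i)
    base : Fin n' → Pt N
    base i = facetPts j (suc i) ⊝ facetPts j zero
    inward : Pt N
    inward = centre ⊝ facetPts j zero
    flat : ∀ k → (∀ i → Tight (facetPts j i) k) → ∀ i → row k (base i) ≡ 0ℚ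
    flat k t i = trans (dot-⊝ (B k) (facetPts j (suc i)) (facetPts j zero)) (trans (cong₂ _-_ (t (suc i)) (t zero)) (+-inverseʳ (d k)))
    inward≢0 : row j inward ≢ 0ℚ
    inward≢0 e = centre-interior j (trans (≡-by e (sym (dot-⊝ (B j) centre (facetPts j zero)))) (tj zero))

  -- The direction `outward` from the centre to the facet raises both rows, and `ratio` compares the
  -- two rises. Any `z` is corrected by a multiple of `outward` until row `j` vanishes; then
  -- `~-kernel` applies.
  ~-proportional : ∀ {j l} → j ~ l → ∃ λ μ → 0ℚ < μ × (∀ z → InKer S z → row l z ≡ μ * row j z)
  ~-proportional {j} {l} j~l = ratio , ratio>0 , scaled
    where
    p₀ : Pt N
    p₀ = facetPts j zero
    p₀in : InP S p₀
    p₀in = proj₁ (facetPts-in j zero)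
    outward : Pt N
    outward = p₀ ⊝ centre
    climb : ∀ k → Tight p₀ k → 0ℚ < row k outward
    climb k t = subst (0ℚ <_) (sym (trans (dot-⊝ (B k) p₀ centre) (cong (_- row k centre) t))) (slack>0 centre-InP k (centre-interior k))
    posj : 0ℚ < row j outward
    posj = climb j (proj₂ (facetPts-in j zero))
    posl : 0ℚ < row l outward
    posl = climb l (~-tight j~l p₀in (proj₂ (facetPts-in j zero)))
    quot = quotient⁺ posj posl
    inv = inverse⁺ posj
    ratio : ℚ
    ratio = proj₁ quot
    ratio>0 : 0ℚ < ratio
    ratio>0 = proj₁ (proj₂ quot)
    i : ℚ
    i = proj₁ inv
    scaled : ∀ z → InKer S z → row l z ≡ ratio * row j z
    scaled z kz = ≡-by
      (cong₂ _+_ (~-kernel j~l z' (ker-ray (- (row j z * i)) kz (ker-⊝ p₀in centre-InP)) jz')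
                 (trans (cong (λ t → ratio * row j z * (t - 1ℚ)) (proj₂ (proj₂ inv))) (*-zeroʳ (ratio * row j z))))
      (trans (lem (row l z) (row j z) i ratio (row j outward))
        (cong (_+ ratio * row j z * (row j outward * i - 1ℚ))
          (trans (cong (λ t → row l z + - (row j z * i) * t) (proj₂ (proj₂ quot))) (sym (dot-ray (B l) z (- (row j z * i)) outward)))))
      where
      z' : Pt N
      z' = z +[ - (row j z * i) ]· outward
      lem₀ : ∀ x i o → x + - (x * i) * o ≡ - (x * (o * i - 1ℚ))
      lem₀ = solve-∀ ℚ-ring
      jz' : row j z' ≡ 0ℚ
      jz' = trans (dot-ray (B j) z (- (row j z * i)) outward) (trans (lem₀ (row j z) i (row j outward))
        (trans (cong (λ t → - (row j z * (t - 1ℚ))) (proj₂ (proj₂ inv))) (cong -_ (*-zeroʳ (row j z)))))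
      lem : ∀ lz jz i r o → lz - r * jz ≡ lz + - (jz * i) * (r * o) + r * jz * (o * i - 1ℚ)
      lem = solve-∀ ℚ-ring

  -- Let `q` be a relative interior point of `G`. With no row tight at `q`, the supporting
  -- functional would be constant and `G` the whole polytope. A row tight at `q` is tight at all the
  -- spanning points of `G`, so its facet is `G`.
  facet-is-row : ∀ {G} → IsFacet S G → ∃ λ j → SameSet G (RowFace j)
  facet-is-row {G} ((c , δ , val , same , _) , k , dP , dG) = find (any? (λ j → tight? q j))
    where
    dG' : HasDim G n'
    dG' = subst (HasDim G) (ℕₚ.suc-injective (HasDim-unique (InP S) (suc k) n dP dimP)) dG
    g : Fin n → Pt N
    g = proj₁ (proj₁ dG')
    gG : ∀ i → InP S (g i) × dot c (g i) ≡ δ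
    gG i = proj₁ (same (g i)) (proj₁ (proj₂ (proj₁ dG')) i)
    pin : ∀ i → InP S (g i)
    pin i = proj₁ (gG i)
    q : Pt N
    q = blend n' g
    qP : InP S q
    qP = blend-InP n' g pin
    qδ : dot c q ≡ δ
    qδ = blend-≡ c δ n' g (λ i → proj₂ (gG i))
    find : Dec (∃ (Tight q)) → _
    find (no none) = ⊥-elim (proj₂ dG' (basePts , (λ i → proj₂ (same (basePts i))
        (pb i , trans (≡-by (face-value-≡ {c} val qP qδ (ker-⊝ (pb i) qP) (λ j t → ⊥-elim (none (j , t)))) (sym (dot-⊝ c (basePts i) q))) qδ)) ,
        proj₂ (proj₂ (proj₁ dimP))))
      where
      pb : ∀ i → InP S (basePts i)
      pb = proj₁ (proj₂ (proj₁ dimP))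
    find (yes (j , t)) = j , λ x →
        (λ Gx → let p , e = proj₁ (same x) Gx in
                p , section-⊆ g (B j) c (d j) δ pin ind tj tc none x p e) ,
        (λ { (p , e) → proj₂ (same x) (p , section-⊆ g c (B j) δ (d j) pin ind tc tj (proj₂ (facetDim j)) x p e) })
      where
      ind = proj₂ (proj₂ (proj₁ dG'))
      tc : ∀ i → dot c (g i) ≡ δ
      tc i = proj₂ (gG i)
      tj : ∀ i → row j (g i) ≡ d j
      tj = blend-tight (B j) (d j) n' g (λ i → proj₂ (pin i) j) t
      none : ¬ Points (λ x → InP S x × dot c x ≡ δ) n
      none (p , pin , ind) = proj₂ dG' (p , (λ i → proj₂ (same (p i)) (pin i)) , ind)

-- Counting and integer multiples

indicator : ∀ {P : Set} → Dec P → ℕ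
indicator (yes _) = 1
indicator (no _)  = 0

count : ∀ m {P : Fin m → Set} → (∀ i → Dec (P i)) → ℕ
count zero    P? = 0
count (suc m) P? = indicator (P? zero) ℕ.+ count m (P? ∘ suc)

indicator-≤ : ∀ {P Q : Set} (p : Dec P) (q : Dec Q) → (P → Q) → indicator p ℕ.≤ indicator q
indicator-≤ (yes p) (yes q) f = ℕₚ.≤-refl
indicator-≤ (yes p) (no q)  f = ⊥-elim (q (f p))
indicator-≤ (no p)  q       f = ℕ.z≤n

indicator-< : ∀ {P Q : Set} (p : Dec P) (q : Dec Q) → ¬ P → Q → indicator p ℕ.< indicator q
indicator-< (yes p) q       n _ = ⊥-elim (n p)
indicator-< (no p)  (yes q) _ _ = ℕ.s≤s ℕ.z≤n
indicator-< (no p)  (no q)  _ y = ⊥-elim (q y)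

count-≤ : ∀ m {P Q : Fin m → Set} (P? : ∀ i → Dec (P i)) (Q? : ∀ i → Dec (Q i)) →
  (∀ i → P i → Q i) → count m P? ℕ.≤ count m Q?
count-≤ zero    P? Q? f = ℕ.z≤n
count-≤ (suc m) P? Q? f = ℕₚ.+-mono-≤ (indicator-≤ (P? zero) (Q? zero) (f zero)) (count-≤ m (P? ∘ suc) (Q? ∘ suc) (f ∘ suc))

count-< : ∀ m {P Q : Fin m → Set} (P? : ∀ i → Dec (P i)) (Q? : ∀ i → Dec (Q i)) →
  (∀ i → P i → Q i) → ∀ i → ¬ P i → Q i → count m P? ℕ.< count m Q?
count-< (suc m) P? Q? f zero    n y = ℕₚ.+-mono-<-≤ (indicator-< (P? zero) (Q? zero) n y) (count-≤ m (P? ∘ suc) (Q? ∘ suc) (f ∘ suc))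
count-< (suc m) P? Q? f (suc i) n y = ℕₚ.+-mono-≤-< (indicator-≤ (P? zero) (Q? zero) (f zero)) (count-< m (P? ∘ suc) (Q? ∘ suc) (f ∘ suc) i n y)

record Enumeration {m : ℕ} (P : Fin m → Set) (a : ℕ) : Set where
  field
    elem      : Fin a → Fin m
    injective : ∀ {x y} → elem x ≡ elem y → x ≡ y
    sound     : ∀ x → P (elem x)
    complete  : ∀ i → P i → ∃ λ x → elem x ≡ i

enum-zero : ∀ {P : Fin 0 → Set} → Enumeration P 0
enum-zero = record { elem = λ () ; injective = λ {} ; sound = λ () ; complete = λ () }

enum-skip : ∀ {m a} {P : Fin (suc m) → Set} → ¬ P zero → Enumeration (P ∘ suc) a → Enumeration P a
enum-skip n E = record
  { elem = suc ∘ elem ; injective = injective ∘ Finₚ.suc-injective ; sound = sound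
  ; complete = λ { zero p → ⊥-elim (n p) ; (suc i) p → proj₁ (complete i p) , cong suc (proj₂ (complete i p)) } }
  where open Enumeration E

enum-take : ∀ {m a} {P : Fin (suc m) → Set} → P zero → Enumeration (P ∘ suc) a → Enumeration P (suc a)
enum-take {m} {a} {P} p E = record
  { elem = elem' ; injective = λ {x} {y} → inj x y ; sound = λ { zero → p ; (suc x) → sound x }
  ; complete = λ { zero _ → zero , refl ; (suc i) q → suc (proj₁ (complete i q)) , cong suc (proj₂ (complete i q)) } }
  where
  open Enumeration E
  elem' : Fin (suc a) → Fin (suc m)
  elem' zero    = zero
  elem' (suc x) = suc (elem x)
  inj : ∀ x y → elem' x ≡ elem' y → x ≡ y
  inj zero    zero    _ = refl
  inj (suc x) (suc y) e = cong suc (injective (Finₚ.suc-injective e))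

partition : ∀ m {P : Fin m → Set} → (∀ i → Dec (P i)) →
  ∃ λ a → ∃ λ b → a ℕ.+ b ≡ m × Enumeration P a × Enumeration (λ i → ¬ P i) b
partition zero    P? = 0 , 0 , refl , enum-zero , enum-zero
partition (suc m) P? with P? zero | partition m (P? ∘ suc)
... | yes p | a , b , e , E , E' = suc a , b , cong suc e , enum-take p E , enum-skip (λ n → n p) E'
... | no n  | a , b , e , E , E' = a , suc b , trans (ℕₚ.+-suc a b) (cong suc e) , enum-skip n E , enum-take n E'

representatives : ∀ m (R : Fin m → Fin m → Set) → (∀ i j → Dec (R i j)) → (∀ {i} → R i i) →
  (∀ {i j} → R i j → R j i) →
  ∃ λ K → ∃ λ (r : Fin K → Fin m) → (∀ i j → R (r i) (r j) → i ≡ j) × (∀ l → ∃ λ i → R l (r i))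
representatives zero R R? rf sy = 0 , (λ ()) , (λ ()) , λ ()
representatives (suc m) R R? rf sy with representatives m (λ i j → R (suc i) (suc j)) (λ i j → R? (suc i) (suc j)) rf sy
... | K , r , inj , cov with any? (λ i → R? zero (suc (r i)))
...   | yes (i , z) = K , suc ∘ r , inj , λ { zero → i , z ; (suc l) → cov l }
...   | no none = suc K , r' , inj' , λ { zero → zero , rf ; (suc l) → suc (proj₁ (cov l)) , proj₂ (cov l) }
  where
  r' : Fin (suc K) → Fin (suc m)
  r' zero    = zero
  r' (suc i) = suc (r i)
  inj' : ∀ i j → R (r' i) (r' j) → i ≡ j
  inj' zero    zero    _ = refl
  inj' zero    (suc j) e = ⊥-elim (none (j , e))
  inj' (suc i) zero    e = ⊥-elim (none (i , sy e))
  inj' (suc i) (suc j) e = cong suc (inj i j e)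

/1-* : ∀ a b → (a ℤ.* b) / 1 ≡ (a / 1) * (b / 1)
/1-* a b = toℚᵘ-injective (ℚᵘₚ.≃-trans (toℚᵘ-fromℚᵘ (ℚᵘ.mkℚᵘ (a ℤ.* b) 0))
  (ℚᵘₚ.≃-sym (ℚᵘₚ.≃-trans (toℚᵘ-homo-* (a / 1) (b / 1))
    (ℚᵘₚ.*-cong (toℚᵘ-fromℚᵘ (ℚᵘ.mkℚᵘ a 0)) (toℚᵘ-fromℚᵘ (ℚᵘ.mkℚᵘ b 0))))))

/1-numerator : ∀ p → (↥ p) / 1 ≡ (↧ p / 1) * p
/1-numerator p@record{} = toℚᵘ-injective (ℚᵘₚ.≃-trans (toℚᵘ-fromℚᵘ (ℚᵘ.mkℚᵘ (↥ p) 0))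
  (ℚᵘₚ.≃-sym (ℚᵘₚ.≃-trans (toℚᵘ-homo-* (↧ p / 1) p)
    (ℚᵘₚ.≃-trans (ℚᵘₚ.*-congʳ {toℚᵘ p} (toℚᵘ-fromℚᵘ (ℚᵘ.mkℚᵘ (↧ p) 0))) (ℚᵘ.*≡* cross)))))
  where
  cross : (↧ p ℤ.* ↥ p) ℤ.* ℤ.+ 1 ≡ ↥ p ℤ.* ℤ.+ (1 ℕ.* ↧ₙ p)
  cross = trans (ℤₚ.*-identityʳ _) (trans (ℤₚ.*-comm (↧ p) (↥ p)) (cong (λ t → ↥ p ℤ.* ℤ.+ t) (sym (ℕₚ.*-identityˡ (↧ₙ p)))))

/1-positive : ∀ k → 0ℚ < ℤ.+ suc k / 1
/1-positive k = positive⁻¹ (ℤ.+ suc k / 1) {{normalize-pos (suc k) 1}}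

-- The multiplier is the product of the denominators; writing it as `suc D` keeps it visibly
-- positive.
clear-denominators : ∀ N (g : Pt N) → ∃ λ D → ∃ λ (y : Fin N → ℤ) → ∀ i → y i / 1 ≡ (ℤ.+ suc D / 1) * g i
clear-denominators zero g = 0 , (λ ()) , λ ()
clear-denominators (suc N) g with clear-denominators N (g ∘ suc)
... | D , y , e = D' , y' , e'
  where
  D' : ℕ
  D' = ℕ.pred (↧ₙ (g zero) ℕ.* suc D)
  scale : ℤ.+ suc D' / 1 ≡ (↧ (g zero) / 1) * (ℤ.+ suc D / 1)
  scale = trans (cong (λ t → t / 1) (ℤₚ.pos-* (↧ₙ (g zero)) (suc D))) (/1-* (↧ (g zero)) (ℤ.+ suc D))
  y' : Fin (suc N) → ℤ
  y' zero    = ↥ (g zero) ℤ.* ℤ.+ suc D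
  y' (suc i) = ↧ (g zero) ℤ.* y i
  lem₁ : ∀ q p D → (q * p) * D ≡ (q * D) * p
  lem₁ = solve-∀ ℚ-ring
  e' : ∀ i → y' i / 1 ≡ (ℤ.+ suc D' / 1) * g i
  e' zero = trans (/1-* (↥ (g zero)) (ℤ.+ suc D)) (trans (cong (_* (ℤ.+ suc D / 1)) (/1-numerator (g zero)))
    (trans (lem₁ (↧ (g zero) / 1) (g zero) (ℤ.+ suc D / 1)) (cong (_* g zero) (sym scale))))
  e' (suc i) = trans (/1-* (↧ (g zero)) (y i)) (trans (cong ((↧ (g zero) / 1) *_) (e i))
    (trans (sym (*-assoc (↧ (g zero) / 1) (ℤ.+ suc D / 1) (g (suc i)))) (cong (_* g (suc i)) (sym scale))))

common-gcd : ∀ N (y : Fin N → ℕ) → ∃ λ G → (∀ i → G ∣ y i) × (∀ k → (∀ i → k ∣ y i) → k ∣ G)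
common-gcd zero y = 0 , (λ ()) , λ k _ → k ∣0
common-gcd (suc N) y with common-gcd N (y ∘ suc)
... | G , dv , gr = gcd (y zero) G ,
  (λ { zero → gcd[m,n]∣m (y zero) G ; (suc i) → ∣-trans (gcd[m,n]∣n (y zero) G) (dv i) }) ,
  (λ k f → gcd-greatest (f zero) (gr k (f ∘ suc)))

coprime-multiple : ∀ N (g : Pt N) → (∃ λ i → g i ≢ 0ℚ) →
  ∃ λ (z : Fin N → ℤ) → ∃ λ μ → 0ℚ < μ × (∀ i → z i / 1 ≡ μ * g i) ×
    (∀ k → (∀ j → k ∣ ℤ.∣ z j ∣) → k ≡ 1)
coprime-multiple N g (i₀ , nz) with clear-denominators N g
... | D , y , e with common-gcd N (λ i → ℤ.∣ y i ∣)
...   | zero , dv , gr = ⊥-elim (nz (*-cancel-0 (pos⇒≢0 (/1-positive D)) (trans (sym (e i₀)) (cong (λ t → t / 1) y0))))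
  where
  -- A vanishing common divisor would make every component zero.
  y0 : y i₀ ≡ ℤ.+ 0
  y0 = ℤₚ.∣i∣≡0⇒i≡0 (0∣⇒≡0 (dv i₀))
...   | suc G , dv , gr = z , proj₁ quot , proj₁ (proj₂ quot) , ez , coprime
  where
  div : ∀ i → ℤ.+ suc G Signed.∣ y i
  div i = Signed.∣ᵤ⇒∣ (dv i)
  z : Fin N → ℤ
  z i = Signed._∣_.quotient (div i)
  yz : ∀ i → y i ≡ z i ℤ.* ℤ.+ suc G
  yz i = Signed._∣_.equality (div i)
  quot = quotient⁺ (/1-positive G) (/1-positive D)
  lem : ∀ z G μ D g → z * G ≡ D * g → μ * G ≡ D → G * (z - μ * g) ≡ 0ℚ
  lem z G μ D g e₁ e₂ = trans (lem₁ z G μ g) (trans (cong₂ (λ s t → s - t * g) e₁ e₂) (+-inverseʳ (D * g)))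
    where lem₁ : ∀ z G μ g → G * (z - μ * g) ≡ z * G - (μ * G) * g
          lem₁ = solve-∀ ℚ-ring
  ez : ∀ i → z i / 1 ≡ proj₁ quot * g i
  ez i = ≡-by (*-cancel-0 (pos⇒≢0 (/1-positive G)) (lem (z i / 1) (ℤ.+ suc G / 1) (proj₁ quot) (ℤ.+ suc D / 1) (g i)
    (trans (sym (/1-* (z i) (ℤ.+ suc G))) (trans (cong (λ t → t / 1) (sym (yz i))) (e i))) (proj₂ (proj₂ quot)))) refl
  coprime : ∀ k → (∀ j → k ∣ ℤ.∣ z j ∣) → k ≡ 1
  -- A common divisor `k` of the quotients gives the common divisor `k ℕ.* suc G` of `y`, which must
  -- divide the greatest one, `suc G`.
  coprime k f = ∣1⇒≡1 (*-cancelʳ-∣ (suc G) (subst (k ℕ.* suc G ∣_) (sym (ℕₚ.*-identityˡ (suc G)))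
    (gr (k ℕ.* suc G) (λ i → subst (k ℕ.* suc G ∣_) (sym (trans (cong ℤ.∣_∣ (yz i)) (ℤₚ.abs-* (z i) (ℤ.+ suc G)))) (*-monoˡ-∣ (suc G) (f i))))))

-- Dual bases at simple vertices

module SimplePolytope {N : ℕ} (S : System N) (n' : ℕ) (bounded : Bounded S)
    (dimP : HasDim (InP S) (suc n')) (minimal : MinimalRep S) (simple : Simple S (suc n')) where
  open System S
  open Polytope S n' bounded dimP minimal public

  -- One row per facet through `u`, and the edge directions dual to them. The sign in `e-diag` makes
  -- `e i` point into the polytope, so the coordinates of a direction are the negated rows and are
  -- nonnegative exactly on the feasible cone.
  record Frame (u : Pt N) : Set where
    field
      r       : Fin n → Fin m₂
      r-tight : ∀ i → Tight u (r i)
      r-inj   : ∀ i k → r i ~ r k → i ≡ k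
      cover   : ∀ l → Tight u l → ∃ λ i → r i ~ l
      rigid   : ∀ z → InKer S z → (∀ i → row (r i) z ≡ 0ℚ) → ∀ s → z s ≡ 0ℚ
      e       : Fin n → Pt N
      e-ker   : ∀ i → InKer S (e i)
      e-diag  : ∀ i → row (r i) (e i) ≡ - 1ℚ
      e-off   : ∀ i k → i ≢ k → row (r i) (e k) ≡ 0ℚ

  module FrameProperties {u : Pt N} (F : Frame u) where
    open Frame F

    cover-sign : ∀ l → Tight u l → ∃ λ i → ∃ λ μ → 0ℚ < μ × (∀ z → InKer S z → row l z ≡ μ * row (r i) z)
    cover-sign l t = let i , ri~l = cover l t in i , ~-proportional ri~l

    feasible : ∀ {g} → InKer S g → (∀ i → row (r i) g ≤ 0ℚ) → Feasible u g
    feasible {g} k le = k , λ l t → let i , μ , μ>0 , eq = cover-sign l t in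
      subst (_≤ 0ℚ) (sym (eq g k)) (*-≤0 (<⇒≤ μ>0) (le i))

    e≤0 : ∀ k i → row (r i) (e k) ≤ 0ℚ
    e≤0 k i with i Finₚ.≟ k
    ... | yes refl = subst (_≤ 0ℚ) (sym (e-diag i)) (<⇒≤ (negative⁻¹ (- 1ℚ)))
    ... | no ne    = ≤-reflexive (e-off i k ne)

    e-feasible : ∀ k → Feasible u (e k)
    e-feasible k = feasible (e-ker k) (e≤0 k)

    -- This removes the component of `h` along `e i`. The remaining coordinates are unchanged, so
    -- the rest still lies in the cone.
    drop-edge : ∀ {h} → Feasible u h → ∀ i → Feasible u (h +[ row (r i) h ]· e i)
    drop-edge {h} (kh , fh) i = feasible (ker-ray (row (r i) h) kh (e-ker i)) le
      where
      lem₁ : ∀ x → x + x * - 1ℚ ≡ 0ℚ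
      lem₁ = solve-∀ ℚ-ring
      le : ∀ s → row (r s) (h +[ row (r i) h ]· e i) ≤ 0ℚ
      le s with s Finₚ.≟ i
      ... | yes refl = ≤-reflexive (trans (dot-ray (B (r s)) h (row (r s) h) (e s))
                         (trans (cong (λ t → row (r s) h + row (r s) h * t) (e-diag s)) (lem₁ (row (r s) h))))
      ... | no ne = subst (_≤ 0ℚ) (sym (trans (dot-ray (B (r s)) h (row (r i) h) (e i))
              (trans (cong (λ t → row (r s) h + row (r i) h * t) (e-off s i ne)) (trans (cong (row (r s) h +_) (*-zeroʳ (row (r i) h))) (+-identityʳ _)))))
              (fh (r s) (r-tight s))

    row-comb : ∀ (a : Fin n → ℚ) i → row (r i) (comb n a e) ≡ - a i
    row-comb a i = trans (dot-comb (B (r i)) n a e)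
      (trans (sumF-single n i (λ k ne → trans (cong (a k *_) (e-off i k (ne ∘ sym))) (*-zeroʳ (a k))))
        (trans (cong (a i *_) (e-diag i)) (lem (a i))))
      where lem : ∀ a → a * - 1ℚ ≡ - a
            lem = solve-∀ ℚ-ring

    expand : ∀ z → InKer S z → ∀ l → row l z ≡ sumF n (λ i → - row (r i) z * row l (e i))
    expand z kz l = trans (≡-by (dot-0 (B l) vanish) (sym (dot-⊝ (B l) z E))) (dot-comb (B l) n a e)
      where
      a : Fin n → ℚ
      a i = - row (r i) z
      E : Pt N
      E = comb n a e
      lem : ∀ a → a - - - a ≡ 0ℚ
      lem = solve-∀ ℚ-ring
      vanish : ∀ s → (z ⊝ E) s ≡ 0ℚ
      vanish = rigid (z ⊝ E)
        (λ t → trans (dot-⊝ (A t) z E) (trans (cong₂ _-_ (kz t) (ker-comb n a e e-ker t)) (+-inverseʳ 0ℚ)))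
        (λ i → trans (dot-⊝ (B (r i)) z E) (trans (cong (λ t → row (r i) z - t) (row-comb a i)) (lem (row (r i) z))))

    -- Row `l` rises from `u` to any point `p` of its facet, and `p ⊝ u` is a nonnegative
    -- combination of the edges, so some edge must raise it.
    rising-edge : InP S u → ∀ l → ¬ Tight u l → ∃ λ i → 0ℚ < row l (e i)
    rising-edge pu l nt with any? (λ i → 0ℚ <? row l (e i))
    ... | yes ex = ex
    ... | no none = ⊥-elim (<-irrefl refl (<-≤-trans up down))
      where
      p : Pt N
      p = facetPts l zero
      pin : InP S p
      pin = proj₁ (facetPts-in l zero)
      kz : InKer S (p ⊝ u)
      kz = ker-⊝ pin pu
      up : 0ℚ < row l (p ⊝ u)
      up = subst (0ℚ <_) (sym (trans (dot-⊝ (B l) p u) (cong (_- row l u) (proj₂ (facetPts-in l zero))))) (slack>0 pu l nt)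
      lem : ∀ d p x → (d - p) * - x ≡ - (- (p - d) * x)
      lem = solve-∀ ℚ-ring
      term : ∀ i → - row (r i) (p ⊝ u) * row l (e i) ≤ 0ℚ
      term i = 0≤-⁻¹ (subst (0ℚ ≤_) (trans (lem (d (r i)) (row (r i) p) (row l (e i)))
          (cong (λ t → - (- t * row l (e i))) (sym (trans (dot-⊝ (B (r i)) p u) (cong (λ t → row (r i) p - t) (r-tight i))))))
        (0≤* (slack≥0 pin (r i)) (0≤- (≮⇒≥ (λ x → none (i , x))))))
      down : row l (p ⊝ u) ≤ 0ℚ
      down = subst₂ _≤_ (sym (expand (p ⊝ u) kz l)) (sumF-0 n {λ _ → 0ℚ} (λ _ → refl)) (sumF-mono n term)

  frame : ∀ {u} → Vertex S u → Frame u
  frame {u} V = record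
    { r = r ; r-tight = r-tight ; r-inj = r-inj ; cover = cover ; rigid = rigid
    ; e = e ; e-ker = λ k → ker-comb n (proj₁ (dual k)) w w-ker
    ; e-diag = λ i → trans (e-value i i) (target-diag i) ; e-off = λ i k ne → trans (e-value i k) (target-off i k ne) }
    where
    facets = simple u V
    Fs : Fin n → PSet N
    Fs = proj₁ facets
    row-of : ∀ i → ∃ λ j → SameSet (Fs i) (RowFace j)
    row-of i = facet-is-row (proj₁ (proj₁ (proj₂ facets) i))
    r : Fin n → Fin m₂
    r i = proj₁ (row-of i)
    r-tight : ∀ i → Tight u (r i)
    r-tight i = proj₂ (proj₁ (proj₂ (row-of i) u) (proj₂ (proj₁ (proj₂ facets) i)))
    r-inj : ∀ i k → r i ~ r k → i ≡ k
    r-inj i k s = proj₁ (proj₂ (proj₂ facets)) i k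
      (SameSet-trans (proj₂ (row-of i)) (SameSet-trans s (SameSet-sym (proj₂ (row-of k)))))
    cover : ∀ l → Tight u l → ∃ λ i → r i ~ l
    cover l t = let i , s = proj₂ (proj₂ (proj₂ facets)) (RowFace l) (minimal l) (Vertex-InP V , t) in
      i , SameSet-sym (SameSet-trans s (proj₂ (row-of i)))
    rigid : ∀ z → InKer S z → (∀ i → row (r i) z ≡ 0ℚ) → ∀ s → z s ≡ 0ℚ
    rigid z kz zr = Vertex⇒Rigid V z kz (λ j t → let i , s = cover j t in ~-kernel s z kz (zr i))
    w : Fin n → Pt N
    w k = basePts (suc k) ⊝ basePts zero
    w-ker : ∀ k → InKer S (w k)
    w-ker k = ker-⊝ (proj₁ (proj₂ (proj₁ dimP)) (suc k)) (proj₁ (proj₂ (proj₁ dimP)) zero)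
    -- The matrix of the tight rows in the kernel vectors `w`. Rigidity of the vertex makes it
    -- invertible, and solving against negated unit vectors gives the dual edges.
    cols : Fin n → Pt n
    cols k i = row (r i) (w k)
    cols-ind : LinIndep n cols
    cols-ind a z = proj₂ (proj₂ (proj₁ dimP)) a (rigid (comb n a w) (ker-comb n a w w-ker)
      (λ i → trans (dot-comb (B (r i)) n a w) (z i)))
    target : Fin n → Pt n
    target k i with i Finₚ.≟ k
    ... | yes _ = - 1ℚ
    ... | no _  = 0ℚ
    target-diag : ∀ i → target i i ≡ - 1ℚ
    target-diag i with i Finₚ.≟ i
    ... | yes _ = refl
    ... | no ne = ⊥-elim (ne refl)
    target-off : ∀ i k → i ≢ k → target k i ≡ 0ℚ
    target-off i k ne with i Finₚ.≟ k
    ... | yes eq = ⊥-elim (ne eq)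
    ... | no _   = refl
    dual : ∀ k → ∃ λ (x : Fin n → ℚ) → ∀ i → sumF n (λ s → x s * cols s i) ≡ target k i
    dual k = solve-square n cols cols-ind (target k)
    e : Fin n → Pt N
    e k = comb n (proj₁ (dual k)) w
    e-value : ∀ i k → row (r i) (e k) ≡ target k i
    e-value i k = trans (dot-comb (B (r i)) n (proj₁ (dual k)) w) (proj₂ (dual k) i)

  ConeProperty : Set
  ConeProperty = ∀ {u} → Vertex S u → ∀ {g} → Feasible u g → ∀ l → ¬ Tight u l → 0ℚ ≤ row l g

  cone-from-edges : (∀ {u} (V : Vertex S u) (F : Frame u) l → ¬ Tight u l → ∀ i → 0ℚ ≤ row l (Frame.e F i)) → ConeProperty
  cone-from-edges edges V {g} (kg , f) l nt = subst (0ℚ ≤_) (sym (FrameProperties.expand F g kg l))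
      (sumF-≥0 n (λ i → 0≤* (0≤- (f (r i) (r-tight i))) (edges V F l nt i)))
    where
    F = frame V
    open Frame F

  -- A circuit without the integrality normalisation: support-minimality is invariant under scaling,
  -- and `circuit-of` restores coprime integer components.
  RatCircuit : Pt N → Set
  RatCircuit g = InKer S g × NonZeroPt S g × ¬ (∃ λ x → InKer S x × NonZeroPt S x × SuppStrictSub S x g)

  RatCircuit-scale : ∀ {g h} μ → μ ≢ 0ℚ → (∀ i → h i ≡ μ * g i) → RatCircuit g → RatCircuit h
  RatCircuit-scale {g} {h} μ μ≢0 e (kg , nz , min) =
    (λ i → trans (dot-cong (A i) e) (ker-scale μ kg i)) ,
    (λ z → nz (λ i → *-cancel-0 μ≢0 (trans (sym (e i)) (z i)))) ,
    (λ { (x , kx , nzx , sub , (j , hj , xj)) → min (x , kx , nzx ,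
       (λ i xi gi → sub i xi (trans (row-h i) (trans (cong (μ *_) gi) (*-zeroʳ μ)))) ,
       j , (λ gj → hj (trans (row-h j) (trans (cong (μ *_) gj) (*-zeroʳ μ)))) , xj) })
    where
    row-h : ∀ j → row j h ≡ μ * row j g
    row-h j = trans (dot-cong (B j) e) (dot-scale (B j) μ g)

  circuit-of : ∀ {g} → RatCircuit g → ∃ λ z → ∃ λ μ → 0ℚ < μ × (∀ i → toQ S z i ≡ μ * g i) × Circuit S z
  circuit-of {g} C@(kg , nz , min) = let z , μ , μ>0 , e , cop = coprime-multiple N g (nonZero-at nz)
                                         k , nz' , m = RatCircuit-scale μ (pos⇒≢0 μ>0) e C in
    z , μ , μ>0 , e , k , nz' , cop , m

  -- The double negation avoids deciding support-minimality; it is harmless because every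
  -- use concludes a stable statement.
  minimal-support : ∀ c g → count m₂ (λ j → ¬? (row j g ≟ 0ℚ)) ℕ.≤ c → InKer S g → NonZeroPt S g →
    ¬ ¬ (∃ λ h → RatCircuit h × (∀ j → row j g ≡ 0ℚ → row j h ≡ 0ℚ))
  minimal-support c g le kg nz none = none (g , (kg , nz , smaller c le) , λ j z → z)
    where
    smaller : ∀ c → count m₂ (λ j → ¬? (row j g ≟ 0ℚ)) ℕ.≤ c → ¬ (∃ λ x → InKer S x × NonZeroPt S x × SuppStrictSub S x g)
    smaller c le (x , kx , nzx , sub , (i , gi , xi)) = descend c (ℕₚ.≤-trans less le)
      where
      less : count m₂ (λ j → ¬? (row j x ≟ 0ℚ)) ℕ.< count m₂ (λ j → ¬? (row j g ≟ 0ℚ))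
      less = count-< m₂ (λ j → ¬? (row j x ≟ 0ℚ)) (λ j → ¬? (row j g ≟ 0ℚ)) sub i (λ ne → ne xi) gi
      descend : ∀ c → count m₂ (λ j → ¬? (row j x ≟ 0ℚ)) ℕ.< c → ⊥
      descend (suc c) (ℕ.s≤s le') = minimal-support c x le' kx nzx (λ { (h , C , sub') → none (h , C ,
        λ j gj → sub' j (decidable-stable (row j x ≟ 0ℚ) (λ xj → sub j xj gj))) })

-- Circuit walks

module Walks {N : ℕ} (S : System N) (n' : ℕ) (bounded : Bounded S)
    (dimP : HasDim (InP S) (suc n')) (minimal : MinimalRep S) (simple : Simple S (suc n')) where
  open System S
  open SimplePolytope S n' bounded dimP minimal simple public

  MaxCircuitStep : Pt N → (Fin N → ℤ) → Set
  MaxCircuitStep p z = ∃ λ α → 0ℚ < α × InP S (p +[ α ]· toQ S z) × CircuitStep S p (p +[ α ]· toQ S z) ×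
      ∃ λ j → 0ℚ < row j (toQ S z) × Tight (p +[ α ]· toQ S z) j

  circuit-step : ∀ {p} z → InP S p → Circuit S z → Feasible p (toQ S z) → MaxCircuitStep p z
  circuit-step {p} z pin C@(kz , nz , _) f = finish (max-step pin f (ascent pin kz (nonZero-at nz)))
    where
    lem : ∀ p α α' g → (p + α * g) - (p + α' * g) ≡ - ((α' - α) * g)
    lem = solve-∀ ℚ-ring
    -- Row `j` is tight at the end of the step and rises along it, so every longer step violates it.
    beyond : ∀ α j → 0ℚ < row j (toQ S z) → Tight (p +[ α ]· toQ S z) j →
      ∀ α' → α < α' → ¬ InP S (p +[ α' ]· toQ S z)
    beyond α j up t α' lt q' = <-irrefl refl (<-≤-trans (-<0 (0<* (<⇒0<∸ lt) up))
      (subst (0ℚ ≤_) (trans (cong₂ _-_ (trans (sym t) (sym (row-ray α (toQ S z) j))) (sym (row-ray α' (toQ S z) j)))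
        (lem (row j p) α α' (row j (toQ S z)))) (slack≥0 q' j)))
    finish : (∃ λ α → 0ℚ < α × InP S (p +[ α ]· toQ S z) × ∃ λ j → 0ℚ < row j (toQ S z) × Tight (p +[ α ]· toQ S z) j) → _
    finish (α , α>0 , q , j , up , t) = α , α>0 , q , (z , C , α , α>0 , (λ _ → refl) , beyond α j up t) , j , up , t

  prepend : ∀ {p p' v k ys} → InP S p → CircuitStep S p p' → CircuitWalk S p' v k ys → CircuitWalk S p v (suc k) (p ∷ ys)
  prepend {p} {p'} {v} {k} {ys} pin (g , C , α , α>0 , e , beyond) (start , end , inside , steps) =
    (λ _ → refl) , end , (λ { zero → pin ; (suc i) → inside i }) ,
    (λ { zero → g , C , α , α>0 , ≈-trans start e , beyond ; (suc i) → steps i })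

  -- The walk completes a circuit step to a walk between vertices. The two extra clauses serve to
  -- find a vertex of one facet that avoids another: the first facet is never left, and the row of
  -- the second does not rise.
  WalkToVertex : Pt N → Fin m₂ → Set
  WalkToVertex p l = ∃ λ v → ∃ λ k → ∃ λ ys → Vertex S v × CircuitWalk S p v k ys ×
    (∀ j → Tight p j → Tight v j) × row l v ≤ row l p

  -- Circuits come in opposite pairs, and both members respect the rows tight at `p`, so the sign
  -- can be chosen to suit row `l`.
  descending-circuit : ∀ {p} l → InP S p → ∀ z → InKer S z → NonZeroPt S z → (∀ j → Tight p j → row j z ≡ 0ℚ) →
    ¬ ¬ (∃ λ g → Circuit S g × (∀ j → Tight p j → row j (toQ S g) ≡ 0ℚ) × row l (toQ S g) ≤ 0ℚ)
  descending-circuit {p} l pin z kz nz tz none = minimal-support _ z ℕₚ.≤-refl kz nz λ { (h , C , sub) →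
      by-sign h C (λ j t → sub j (tz j t)) (≤-total (row l h) 0ℚ) }
    where
    use : ∀ h → RatCircuit h → (∀ j → Tight p j → row j h ≡ 0ℚ) → row l h ≤ 0ℚ → ⊥
    use h C th le = let g , μ , μ>0 , e , C' = circuit-of C
                        row-g = λ j → trans (dot-cong (B j) e) (dot-scale (B j) μ h) in
      none (g , C' , (λ j t → trans (row-g j) (trans (cong (μ *_) (th j t)) (*-zeroʳ μ))) ,
        subst (_≤ 0ℚ) (sym (row-g l)) (*-≤0 (<⇒≤ μ>0) le))
    lem' : ∀ g → - g ≡ (- 1ℚ) * g
    lem' = solve-∀ ℚ-ring
    by-sign : ∀ h → RatCircuit h → (∀ j → Tight p j → row j h ≡ 0ℚ) → row l h ≤ 0ℚ ⊎ 0ℚ ≤ row l h → ⊥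
    by-sign h C th (inj₁ le) = use h C th le
    by-sign h C th (inj₂ ge) = use (neg h) (RatCircuit-scale (- 1ℚ) (λ ()) (λ i → lem' (h i)) C)
      (λ j t → trans (dot-neg (B j) h) (cong -_ (th j t))) (subst (_≤ 0ℚ) (sym (dot-neg (B l) h)) (-≤0 ge))

  loose? : ∀ p j → Dec (¬ Tight p j)
  loose? p j = ¬? (tight? p j)

  walk-to-vertex : ∀ c p l → count m₂ (loose? p) ℕ.≤ c → InP S p → ¬ ¬ WalkToVertex p l
  -- If `p` is not rigid, a nonzero kernel direction keeps all its tight rows constant, and a
  -- circuit inside the support of that direction allows another step.
  walk-to-vertex c p l le pin none = stuck (Rigid⇒Vertex pin (λ z kz tz i → decidable-stable (z i ≟ 0ℚ) (λ zi →
      descending-circuit l pin z kz (λ all0 → zi (all0 i)) tz (advance c le))))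
    where
    stuck : ¬ Vertex S p
    stuck V = none (p , 0 , (λ _ → p) , V , ((λ _ → refl) , (λ _ → refl) , (λ _ → pin) , λ ()) , (λ _ t → t) , ≤-refl)
    advance : ∀ c → count m₂ (loose? p) ℕ.≤ c →
      ¬ (∃ λ g → Circuit S g × (∀ j → Tight p j → row j (toQ S g) ≡ 0ℚ) × row l (toQ S g) ≤ 0ℚ)
    advance c le (g , C , tg , lg) = descend c (ℕₚ.≤-trans less le)
      where
      moved : MaxCircuitStep p g
      moved = circuit-step g pin C (proj₁ C , λ j t → ≤-reflexive (tg j t))
      α : ℚ
      α = proj₁ moved
      α>0 : 0ℚ < α
      α>0 = proj₁ (proj₂ moved)
      q : InP S (p +[ α ]· toQ S g)
      q = proj₁ (proj₂ (proj₂ moved))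
      step : CircuitStep S p (p +[ α ]· toQ S g)
      step = proj₁ (proj₂ (proj₂ (proj₂ moved)))
      j : Fin m₂
      j = proj₁ (proj₂ (proj₂ (proj₂ (proj₂ moved))))
      up : 0ℚ < row j (toQ S g)
      up = proj₁ (proj₂ (proj₂ (proj₂ (proj₂ (proj₂ moved)))))
      tj : Tight (p +[ α ]· toQ S g) j
      tj = proj₂ (proj₂ (proj₂ (proj₂ (proj₂ (proj₂ moved)))))
      p' : Pt N
      p' = p +[ α ]· toQ S g
      keep : ∀ i → Tight p i → Tight p' i
      keep i t = trans (sym (row-ray α (toQ S g) i)) (trans (cong₂ (λ x y → x + α * y) t (tg i t))
        (trans (cong (d i +_) (*-zeroʳ α)) (+-identityʳ (d i))))
      -- The row `j` that stops the step rises along `g`, so it was loose at `p`; all rows tight at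
      -- `p` stay tight. This is the decreasing measure.
      less : count m₂ (loose? p') ℕ.< count m₂ (loose? p)
      less = count-< m₂ (loose? p') (loose? p) (λ i nt t → nt (keep i t)) j (λ nt → nt tj)
        (λ t → pos⇒≢0 up (tg j t))
      lem : ∀ p α g → p - (p + α * g) ≡ α * - g
      lem = solve-∀ ℚ-ring
      lower : row l p' ≤ row l p
      lower = ≤-by (0≤* (<⇒≤ α>0) (0≤- lg)) (trans (cong (λ t → row l p - t) (sym (row-ray α (toQ S g) l))) (lem (row l p) α (row l (toQ S g))))
      descend : ∀ c → count m₂ (loose? p') ℕ.< c → ⊥
      descend (suc c) (ℕ.s≤s le') = walk-to-vertex c p' l le' q λ { (v , k , ys , V , W , kept , low) →
        none (v , suc k , (p ∷ ys) , V , prepend pin step W , (λ i t → kept i (keep i t)) , ≤-trans low lower) }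

  module FromCircuits (all-edges : AllCircuitWalksAreEdgeWalks S) where

    -- The hypothesis applies only after the step has been continued to a vertex; the first edge of
    -- the resulting walk is then the wanted segment.
    edge-step : ∀ {p} z → Vertex S p → (C : Circuit S z) → Feasible p (toQ S z) →
      ¬ ¬ (∃ λ α → 0ℚ < α × Face S (Segment S p (p +[ α ]· toQ S z)))
    edge-step {p} z V C f none = continue (circuit-step z (Vertex-InP V) C f)
      where
      continue : MaxCircuitStep p z → ⊥
      continue (α , α>0 , q , step , j , _) = walk-to-vertex _ p' j ℕₚ.≤-refl q found
        where
        p' : Pt N
        p' = p +[ α ]· toQ S z
        found : ¬ WalkToVertex p' j
        found (v , k , ys , Vv , W , _) = none (α , α>0 , Face-resp same
            (proj₁ (proj₂ (proj₂ (all-edges p v V Vv (suc k) (p ∷ ys) (prepend (Vertex-InP V) step W))) zero)))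
          where
          start : ys zero ≈ p'
          start = proj₁ W
          same : SameSet (Segment S p (ys zero)) (Segment S p p')
          same x = (λ { (t , lo , hi , e) → t , lo , hi , λ i → trans (e i) (cong (λ s → p i + t * (s - p i)) (start i)) }) ,
                   (λ { (t , lo , hi , e) → t , lo , hi , λ i → trans (e i) (cong (λ s → p i + t * (s - p i)) (sym (start i))) })

    -- The step along `h` spans a face, whose functional `c` vanishes on `h`. Since `h` is the sum
    -- of a positive multiple of `e i` and the feasible `rest`, and `c` is positive on neither, `c`
    -- vanishes on `e i`. So `e i` runs inside the segment and is parallel to `h`, which is
    -- impossible if `h` also leaves another facet `r k`.
    circuit-is-edge : ∀ {u} (V : Vertex S u) (F : Frame u) {h} → RatCircuit h → Feasible u h →
      ∀ i k → row (Frame.r F i) h < 0ℚ → row (Frame.r F k) h < 0ℚ → i ≡ k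
    circuit-is-edge {u} V F {h} C (kh , fh) i k hi hk = decidable-stable (i Finₚ.≟ k) contra
      where
      open Frame F
      open FrameProperties F
      contra : i ≢ k → ⊥
      contra i≢k = edge-step z V C' (proj₁ C' , λ j t → subst (_≤ 0ℚ) (sym (row-g j))
          (*-≤0 (<⇒≤ μ>0) (fh j t))) analyse
        where
        scaled = circuit-of C
        z = proj₁ scaled
        μ : ℚ
        μ = proj₁ (proj₂ scaled)
        μ>0 : 0ℚ < μ
        μ>0 = proj₁ (proj₂ (proj₂ scaled))
        C' : Circuit S z
        C' = proj₂ (proj₂ (proj₂ (proj₂ scaled)))
        g : Pt N
        g = toQ S z
        g≈ : g ≈ (λ i → μ * h i)
        g≈ = proj₁ (proj₂ (proj₂ (proj₂ scaled)))
        row-g : ∀ j → row j g ≡ μ * row j h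
        row-g j = trans (dot-cong (B j) g≈) (dot-scale (B j) μ h)
        a : ℚ
        a = - row (r i) h
        a>0 : 0ℚ < a
        a>0 = 0<- hi
        rest : Pt N
        rest = h +[ row (r i) h ]· e i
        rest-feasible : Feasible u rest
        rest-feasible = drop-edge (kh , fh) i
        pu : InP S u
        pu = Vertex-InP V
        analyse : ¬ (∃ λ α → 0ℚ < α × Face S (Segment S u (u +[ α ]· g)))
        analyse (α , α>0 , (c , δ , val , same , _)) = on-segment (nudge pu (e-feasible i))
          where
          y' : Pt N
          y' = u +[ α ]· g
          lem₀ : ∀ u y → u ≡ u + 0ℚ * (y - u)
          lem₀ = solve-∀ ℚ-ring
          lem₁ : ∀ u y → y ≡ u + 1ℚ * (y - u)
          lem₁ = solve-∀ ℚ-ring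
          cu : dot c u ≡ δ
          cu = proj₂ (proj₁ (same u) (0ℚ , ≤-refl , 0≤1 , λ s → lem₀ (u s) (y' s)))
          cy : dot c y' ≡ δ
          cy = proj₂ (proj₁ (same y') (1ℚ , 0≤1 , ≤-refl , λ s → lem₁ (u s) (y' s)))
          lem₂ : ∀ u α μ h → (α * μ) * h ≡ u + α * (μ * h) - u
          lem₂ = solve-∀ ℚ-ring
          ch : dot c h ≡ 0ℚ
          ch = *-cancel-0 (pos⇒≢0 (0<* α>0 μ>0)) (trans (lem₂ (dot c u) α μ (dot c h))
            (trans (cong (λ t → dot c u + α * t - dot c u) (sym (trans (dot-cong c g≈) (dot-scale c μ h))))
            (trans (cong (_- dot c u) (trans (sym (dot-ray c u α g)) (trans cy (sym cu)))) (+-inverseʳ (dot c u)))))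
          lem₃ : ∀ x e → - (0ℚ + x * e) ≡ - x * e
          lem₃ = solve-∀ ℚ-ring
          ce : dot c (e i) ≡ 0ℚ
          ce = ≤-antisym (face-value-≤ {c} val pu cu (e-feasible i))
            (0≤-cancel a>0 (subst (0ℚ ≤_) (trans (cong -_ (trans (dot-ray c h (row (r i) h) (e i))
                (cong (_+ row (r i) h * dot c (e i)) ch))) (lem₃ (row (r i) h) (dot c (e i))))
              (0≤- (face-value-≤ {c} val pu cu rest-feasible))))
          on-segment : (∃ λ ε → 0ℚ < ε × InP S (u +[ ε ]· e i)) → ⊥
          on-segment (ε , ε>0 , q) = pos⇒≢0 ε>0 (-≡0 (trans (lem₅ ε) (trans (cong (ε *_) (sym (e-diag i))) (trans (along (r i))
              (trans (cong (_* row (r i) h) t0) (*-zeroˡ (row (r i) h)))))))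
            where
            lem₅ : ∀ ε → - ε ≡ ε * - 1ℚ
            lem₅ = solve-∀ ℚ-ring
            seg : Segment S u y' (u +[ ε ]· e i)
            seg = proj₂ (same (u +[ ε ]· e i)) (q , trans (dot-ray c u ε (e i))
              (trans (cong₂ _+_ cu (trans (cong (ε *_) ce) (*-zeroʳ ε))) (+-identityʳ δ)))
            t : ℚ
            t = proj₁ seg
            lem₆ : ∀ u x → x ≡ u + x - u
            lem₆ = solve-∀ ℚ-ring
            lem₇ : ∀ u t α μ h → u + t * (u + α * (μ * h) - u) - u ≡ (t * (α * μ)) * h
            lem₇ = solve-∀ ℚ-ring
            along : ∀ j → ε * row j (e i) ≡ (t * (α * μ)) * row j h
            along j = trans (lem₆ (row j u) (ε * row j (e i)))
              (trans (cong (_- row j u) (trans (row-ray ε (e i) j) (trans (dot-cong (B j) (proj₂ (proj₂ (proj₂ seg))))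
                 (trans (dot-ray (B j) u t (y' ⊝ u)) (cong (λ s → row j u + t * s) (trans (dot-⊝ (B j) y' u)
                   (cong (_- row j u) (trans (dot-ray (B j) u α g) (cong (λ s → row j u + α * s) (row-g j))))))))))
               (lem₇ (row j u) t α μ (row j h)))
            -- Row `r k` vanishes on `e i` but not on `h`; reading `along` there makes the factor
            -- zero, and reading it at `r i` then gives the contradiction.
            t0 : t * (α * μ) ≡ 0ℚ
            t0 = *-cancel-0 (λ z → <⇒≢ hk z) (trans (*-comm (row (r k) h) (t * (α * μ)))
              (trans (sym (along (r k))) (trans (cong (ε *_) (e-off k i (i≢k ∘ sym))) (*-zeroʳ ε))))

    edge-cone : ∀ {u} (V : Vertex S u) (F : Frame u) l → ¬ Tight u l → ∀ i → 0ℚ ≤ row l (Frame.e F i)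
    edge-cone {u} V F l nt i = decidable-stable (0ℚ ≤? row l (Frame.e F i)) λ neg' →
        contra (≰⇒> neg') (FrameProperties.rising-edge F (Vertex-InP V) l nt)
      where
      open Frame F
      open FrameProperties F
      contra : row l (e i) < 0ℚ → (∃ λ k → 0ℚ < row l (e k)) → ⊥
      contra down (k , up) = minimal-support _ g ℕₚ.≤-refl kg g≢0 finish
        where
        β γ : ℚ
        β = row l (e k)
        γ = - row l (e i)
        i≢k : i ≢ k
        i≢k refl = <-asym down up
        g : Pt N
        g = (λ s → β * e i s) +[ γ ]· e k
        row-g : ∀ j → row j g ≡ β * row j (e i) + γ * row j (e k)
        row-g j = trans (dot-ray (B j) (λ s → β * e i s) γ (e k)) (cong (_+ γ * row j (e k)) (dot-scale (B j) β (e i)))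
        kg : InKer S g
        kg = ker-ray γ (ker-scale β (e-ker i)) (e-ker k)
        lem : ∀ x y → x * y + (- y) * x ≡ 0ℚ
        lem = solve-∀ ℚ-ring
        lg : row l g ≡ 0ℚ
        lg = trans (row-g l) (lem β (row l (e i)))
        others : ∀ s → s ≢ i → s ≢ k → row (r s) g ≡ 0ℚ
        others s si sk = trans (row-g (r s)) (trans (cong₂ (λ x y → β * x + γ * y) (e-off s i si) (e-off s k sk))
          (trans (cong₂ _+_ (*-zeroʳ β) (*-zeroʳ γ)) refl))
        g≢0 : NonZeroPt S g
        g≢0 z = pos⇒≢0 up (-≡0 (trans (lem₁ β γ) (trans (sym (trans (row-g (r i)) (cong₂ (λ x y → β * x + γ * y) (e-diag i) (e-off i k i≢k))))
          (dot-0 (B (r i)) z))))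
          where lem₁ : ∀ β γ → - β ≡ β * - 1ℚ + γ * 0ℚ
                lem₁ = solve-∀ ℚ-ring
        finish : ¬ (∃ λ h → RatCircuit h × (∀ j → row j g ≡ 0ℚ → row j h ≡ 0ℚ))
        finish (h , C@(kh , nz , _) , sub) = by-sign (<-cmp hi 0ℚ)
          where
          hi hk : ℚ
          hi = row (r i) h
          hk = row (r k) h
          -- The support of `h` lies in that of `g`, so `r i` and `r k` are the only frame rows that
          -- can be nonzero on `h`; `E` is its expansion in the dual basis.
          E : Pt N
          E = (λ s → - hi * e i s) +[ - hk ]· e k
          row-E : ∀ j → row j E ≡ - hi * row j (e i) + - hk * row j (e k)
          row-E j = trans (dot-ray (B j) (λ s → - hi * e i s) (- hk) (e k)) (cong (_+ - hk * row j (e k)) (dot-scale (B j) (- hi) (e i)))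
          lemᵢ : ∀ x y → x - (- x * - 1ℚ + - y * 0ℚ) ≡ 0ℚ
          lemᵢ = solve-∀ ℚ-ring
          lemₖ : ∀ x y → y - (- x * 0ℚ + - y * - 1ℚ) ≡ 0ℚ
          lemₖ = solve-∀ ℚ-ring
          lemₛ : ∀ x y → 0ℚ - (- x * 0ℚ + - y * 0ℚ) ≡ 0ℚ
          lemₛ = solve-∀ ℚ-ring
          difference : ∀ s → row (r s) (h ⊝ E) ≡ 0ℚ
          difference s = trans (dot-⊝ (B (r s)) h E) (trans (cong (λ t → row (r s) h - t) (row-E (r s))) (cases (s Finₚ.≟ i) (s Finₚ.≟ k)))
            where
            cases : Dec (s ≡ i) → Dec (s ≡ k) → row (r s) h - (- hi * row (r s) (e i) + - hk * row (r s) (e k)) ≡ 0ℚ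
            cases (yes refl) _ = trans (cong₂ (λ x y → hi - (- hi * x + - hk * y)) (e-diag i) (e-off i k i≢k)) (lemᵢ hi hk)
            cases (no _) (yes refl) = trans (cong₂ (λ x y → hk - (- hi * x + - hk * y)) (e-off k i (i≢k ∘ sym)) (e-diag k)) (lemₖ hi hk)
            cases (no si) (no sk) = trans (cong₂ _-_ (sub (r s) (others s si sk)) (cong₂ (λ x y → - hi * x + - hk * y) (e-off s i si) (e-off s k sk))) (lemₛ hi hk)
          h≈E : ∀ s → (h ⊝ E) s ≡ 0ℚ
          h≈E = rigid (h ⊝ E) (λ t → trans (dot-⊝ (A t) h E) (trans (cong₂ _-_ (kh t)
            (ker-ray (- hk) (ker-scale (- hi) (e-ker i)) (e-ker k) t)) (+-inverseʳ 0ℚ))) difference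
          balance : - hi * row l (e i) ≡ hk * row l (e k)
          balance = ≡-by (trans (sym (trans (≡-by (dot-0 (B l) h≈E) (sym (dot-⊝ (B l) h E))) (row-E l))) (sub l lg))
            (lem₂ hi (row l (e i)) hk (row l (e k)))
            where lem₂ : ∀ a x b y → - a * x - b * y ≡ - a * x + - b * y
                  lem₂ = solve-∀ ℚ-ring
          -- row l h = 0 forces the two coordinates of h along e i and e k to have the same sign.
          same-sign : ∀ {x y} → - x * row l (e i) ≡ y * row l (e k) → x < 0ℚ → y < 0ℚ
          same-sign {x} {y} bal neg' = subst (_< 0ℚ) (neg-neg y) (-<0 (0<-cancel up (subst (0ℚ <_)
              (trans (sym (lem₆ x (row l (e i)))) (trans (cong -_ bal) (lem₇ y (row l (e k))))) (0<* (0<- neg') (0<- down)))))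
            where
            lem₆ : ∀ x y → - (- x * y) ≡ (- x) * (- y)
            lem₆ = solve-∀ ℚ-ring
            lem₇ : ∀ y b → - (y * b) ≡ b * - y
            lem₇ = solve-∀ ℚ-ring
          conclude : ∀ h' → RatCircuit h' → (∀ s → s ≢ i → s ≢ k → row (r s) h' ≡ 0ℚ) →
            row (r i) h' < 0ℚ → row (r k) h' < 0ℚ → ⊥
          conclude h' C'@(kh' , _) zs ni nk = i≢k (circuit-is-edge V F C' (feasible kh' le) i k ni nk)
            where
            le : ∀ s → row (r s) h' ≤ 0ℚ
            le s with s Finₚ.≟ i | s Finₚ.≟ k
            ... | yes refl | _ = <⇒≤ ni
            ... | no _ | yes refl = <⇒≤ nk
            ... | no si | no sk = ≤-reflexive (zs s si sk)
          zs : ∀ s → s ≢ i → s ≢ k → row (r s) h ≡ 0ℚ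
          zs s si sk = sub (r s) (others s si sk)
          -- Whichever of `h` and `neg h` decreases row `r i` also decreases row `r k`, hence is
          -- feasible at `u`. If row `r i` vanishes on `h`, all frame rows do, and `h` would be
          -- zero.
          by-sign : _ → ⊥
          by-sign (tri< neg' _ _) = conclude h C zs neg' (same-sign balance neg')
          by-sign (tri≈ _ hi0 _) = nz (rigid h kh all0)
            where
            hk0 : hk ≡ 0ℚ
            hk0 = *-cancel-0 (pos⇒≢0 up) (trans (*-comm (row l (e k)) hk) (trans (sym balance)
              (trans (cong (λ t → - t * row l (e i)) hi0) (*-zeroˡ (row l (e i))))))
            all0 : ∀ s → row (r s) h ≡ 0ℚ
            all0 s with s Finₚ.≟ i | s Finₚ.≟ k
            ... | yes refl | _ = hi0
            ... | no _ | yes refl = hk0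
            ... | no si | no sk = zs s si sk
          by-sign (tri> _ _ pos') = conclude (neg h) (RatCircuit-scale (- 1ℚ) (λ ()) (λ s → lem₈ (h s)) C)
              (λ s si sk → trans (dot-neg (B (r s)) h) (cong -_ (zs s si sk)))
              nhi (subst (_< 0ℚ) (sym (dot-neg (B (r k)) h)) (same-sign (trans (lem₉ hi (row l (e i))) (trans (cong -_ balance) (lem₁₀ hk (row l (e k)))))
                     (-<0 pos')))
            where
            lem₈ : ∀ g → - g ≡ (- 1ℚ) * g
            lem₈ = solve-∀ ℚ-ring
            lem₉ : ∀ a x → - - a * x ≡ - (- a * x)
            lem₉ = solve-∀ ℚ-ring
            lem₁₀ : ∀ a x → - (a * x) ≡ - a * x
            lem₁₀ = solve-∀ ℚ-ring
            nhi : row (r i) (neg h) < 0ℚ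
            nhi = subst (_< 0ℚ) (sym (dot-neg (B (r i)) h)) (-<0 pos')

    cone : ConeProperty
    cone = cone-from-edges edge-cone

-- Symmetric inner cones and edge walks

-- Exchanging the two factors, with one sign, gives a relation; it forces the first factor to
-- vanish, and then the first vector alone is dependent.
LinIndep-2-multiples : ∀ {N} (v : Pt N) (a : Fin 2 → ℚ) → ¬ LinIndep 2 (λ i s → a i * v s)
LinIndep-2-multiples v a ind = 1≢0 (ind c (λ s → trans (cong (λ t → 1ℚ * (t * v s) + (0ℚ * (a (suc zero) * v s) + 0ℚ)) a0) (lem₂ (a (suc zero)) (v s))) zero)
  where
  swap : Fin 2 → ℚ
  swap = a (suc zero) ∷ - a zero ∷ λ ()
  lem₁ : ∀ x y v → y * (x * v) + (- x * (y * v) + 0ℚ) ≡ 0ℚ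
  lem₁ = solve-∀ ℚ-ring
  a0 : a zero ≡ 0ℚ
  a0 = -≡0 (ind swap (λ s → lem₁ (a zero) (a (suc zero)) (v s)) (suc zero))
  c : Fin 2 → ℚ
  c = 1ℚ ∷ 0ℚ ∷ λ ()
  lem₂ : ∀ y v → 1ℚ * (0ℚ * v) + (0ℚ * (y * v) + 0ℚ) ≡ 0ℚ
  lem₂ = solve-∀ ℚ-ring

module ConeEquivalences {N : ℕ} (S : System N) (n' : ℕ) (bounded : Bounded S)
    (dimP : HasDim (InP S) (suc n')) (minimal : MinimalRep S) (simple : Simple S (suc n')) where
  open System S
  open Walks S n' bounded dimP minimal simple public

  module FromSymmetric (symmetric : SymmetricInnerCone S) where

    edge-cone : ∀ {u} (V : Vertex S u) (F : Frame u) l → ¬ Tight u l → ∀ i → 0ℚ ≤ row l (Frame.e F i)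
    edge-cone {u} V F l nt i = decidable-stable (0ℚ ≤? row l (e i)) λ down → separate down (compare l (r i))
      where
      open Frame F
      open FrameProperties F
      pu : InP S u
      pu = Vertex-InP V
      reflected : ∀ {v} → Vertex S v → Tight v l → ¬ Tight v (r i) → 0ℚ ≤ row l (e i)
      reflected {v} Vv tl nr = finish (proj₁ (symmetric u v V Vv (faceOf (common u v)) (minFace pu (Vertex-InP Vv)) (e i)) start)
        where
        start : InnerCone S (faceOf (common u v)) u (e i)
        start = let ε , ε>0 , q = nudge pu (e-feasible i) in ε , ε>0 , q , λ { j (tu , tv) →
          trans (sym (row-ray ε (e i) j)) (trans (cong₂ (λ x y → x + ε * y) tu (flat j tu tv))
            (trans (cong (d j +_) (*-zeroʳ ε)) (+-identityʳ (d j)))) }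
          where
          -- Up to `~`, a row tight at both vertices is some `r k`, and `k` differs from `i` because
          -- `r i` is loose at `v`.
          flat : ∀ j → Tight u j → Tight v j → row j (e i) ≡ 0ℚ
          flat j tu tv = let k , s = cover j tu in
            ~-kernel s (e i) (e-ker i) (e-off k i (λ { refl → nr (~-tight (~-sym s) (Vertex-InP Vv) tv) }))
        finish : InnerCone S (faceOf (common u v)) v (neg (e i)) → 0ℚ ≤ row l (e i)
        finish (ε , ε>0 , q , _) = subst (0ℚ ≤_) (trans (cong -_ (dot-neg (B l) (e i))) (neg-neg (row l (e i))))
            (0≤- (proj₂ (in-cone (Vertex-InP Vv) ε>0 q) l tl))
      -- The facets differ because `l` is loose at `u`. From a point of facet `l` off facet `r i`,
      -- the walk keeps `l` tight and does not raise row `r i`, so its final vertex is also off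
      -- `r i`.
      separate : ¬ (0ℚ ≤ row l (e i)) → (l ~ r i ⊎ ∃ λ p → RowFace l p × ¬ Tight p (r i)) → ⊥
      separate down (inj₁ s) = nt (~-tight (~-sym s) pu (r-tight i))
      separate down (inj₂ (p , (pin , tl) , nr)) = walk-to-vertex _ p (r i) ℕₚ.≤-refl pin λ { (v , _ , _ , Vv , _ , keep , low) →
        down (reflected Vv (keep l tl) (λ tv → nr (≤-antisym (proj₂ pin (r i)) (subst (_≤ row (r i) p) tv low)))) }

    cone : ConeProperty
    cone = cone-from-edges edge-cone

  module FromCone (cone : ConeProperty) where

    -- Let `g` be in the inner cone at `u`. Rows tight at both vertices are constant along `g`, and
    -- rows tight only at `v` do not decrease, by the cone property at `u`. Hence `neg g` is
    -- feasible at `v` within the minimal face. Exchanging the vertices gives the other inclusion.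
    symmetric : SymmetricInnerCone S
    symmetric u v V Vv F mF g = reflect V Vv mF , λ ic →
        let ε , ε>0 , q = reflect Vv V (swap mF) ic in ε , ε>0 , Face-cong (proj₁ mF) (λ s → lem (u s) ε (g s)) q
      where
      lem : ∀ u ε g → u + ε * - - g ≡ u + ε * g
      lem = solve-∀ ℚ-ring
      swap : MinFace S u v F → MinFace S v u F
      swap (f , Fu , Fv , least) = f , Fv , Fu , λ G fG Gv Gu → least G fG Gu Gv
      reflect : ∀ {u v g} → Vertex S u → Vertex S v → MinFace S u v F → InnerCone S F u g → InnerCone S F v (neg g)
      reflect {u} {v} {g} V Vv (f , Fu , Fv , least) (ε , ε>0 , Fq) =
        let η , η>0 , q' = nudge pv backwards in
        η , η>0 , proj₂ (proj₂ (proj₂ mf)) F f Fu Fv (v +[ η ]· neg g) (q' , λ j t → still η j t)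
        where
        pu = Vertex-InP V
        pv = Vertex-InP Vv
        mf = minFace pu pv
        q : faceOf (common u v) (u +[ ε ]· g)
        q = least (faceOf (common u v)) (proj₁ mf) (proj₁ (proj₂ mf)) (proj₁ (proj₂ (proj₂ mf))) _ Fq
        fg : Feasible u g
        fg = in-cone pu ε>0 (proj₁ q)
        lem₁ : ∀ u e → e ≡ u + e - u
        lem₁ = solve-∀ ℚ-ring
        flat : ∀ j → common u v j → row j g ≡ 0ℚ
        flat j (tu , tv) = *-cancel-0 (pos⇒≢0 ε>0) (trans (lem₁ (row j u) (ε * row j g))
          (trans (cong₂ _-_ (trans (row-ray ε g j) (proj₂ q j (tu , tv))) tu) (+-inverseʳ (d j))))
        backwards : Feasible v (neg g)
        backwards = ker-neg (proj₁ fg) , λ j tv → subst (_≤ 0ℚ) (sym (dot-neg (B j) g)) (-≤0 (by-cases j tv (tight? u j)))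
          where
          by-cases : ∀ j → Tight v j → Dec (Tight u j) → 0ℚ ≤ row j g
          by-cases j tv (yes tu) = ≤-reflexive (sym (flat j (tu , tv)))
          by-cases j tv (no nu)  = cone V fg j nu
        still : ∀ η j → common u v j → Tight (v +[ η ]· neg g) j
        still η j t = trans (sym (row-ray η (neg g) j)) (trans (cong₂ (λ x y → x + η * y) (proj₂ t)
          (trans (dot-neg (B j) g) (cong -_ (flat j t)))) (trans (cong (d j +_) (*-zeroʳ η)) (+-identityʳ (d j))))

    module EdgeStep {u y' : Pt N} (V : Vertex S u) (py : InP S y') (z : Fin N → ℤ) (C : Circuit S z)
        (α : ℚ) (α>0 : 0ℚ < α) (y≈ : y' ≈ (u +[ α ]· toQ S z))
        (beyond : ∀ α' → α < α' → ¬ InP S (u +[ α' ]· toQ S z)) where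
      F = frame V
      open Frame F
      open FrameProperties F

      pu : InP S u
      pu = Vertex-InP V
      g : Pt N
      g = toQ S z
      kg : InKer S g
      kg = proj₁ C
      fg : Feasible u g
      fg = in-cone pu α>0 (InP-cong y≈ py)

      leaving : ∃ λ i → row (r i) g ≢ 0ℚ
      leaving with any? (λ i → ¬? (row (r i) g ≟ 0ℚ))
      ... | yes ex = ex
      ... | no none = ⊥-elim (proj₁ (proj₂ C) (rigid g kg (λ i → decidable-stable (row (r i) g ≟ 0ℚ) (λ ne → none (i , ne)))))

      i : Fin n
      i = proj₁ leaving
      a : ℚ
      a = - row (r i) g
      a>0 : 0ℚ < a
      a>0 = 0<- (≤∧≢⇒< (proj₂ fg (r i) (r-tight i)) (proj₂ leaving))

      rest : Pt N
      rest = g +[ row (r i) g ]· e i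
      rest-feasible : Feasible u rest
      rest-feasible = drop-edge fg i

      -- On a loose row both `rest` and `e i` are nonnegative by the cone property, so they cannot
      -- cancel. A tight row is proportional to some `r k`, and `k` is not `i` because `g` leaves
      -- `r i`.
      e-support : ∀ l → row l g ≡ 0ℚ → row l (e i) ≡ 0ℚ
      e-support l lg = by-cases (tight? u l)
        where
        by-cases : Dec (Tight u l) → row l (e i) ≡ 0ℚ
        by-cases (yes t) = let k , μ , μ>0 , eq = cover-sign l t in
          trans (eq (e i) (e-ker i)) (trans (cong (μ *_) (e-off k i
            (λ k≡i → proj₂ leaving (subst (λ k → row (r k) g ≡ 0ℚ) k≡i (*-cancel-0 (pos⇒≢0 μ>0) (trans (sym (eq g kg)) lg))))))
            (*-zeroʳ μ))
        by-cases (no nt) = ≤-antisym (0≤-⁻¹ (0≤-cancel a>0 (subst (0ℚ ≤_) (trans (dot-ray (B l) g (row (r i) g) (e i))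
            (trans (cong (_+ row (r i) g * row l (e i)) lg) (lem (row (r i) g) (row l (e i))))) (cone V rest-feasible l nt))))
            (cone V (e-feasible i) l nt)
          where lem : ∀ x y → 0ℚ + x * y ≡ - x * - y
                lem = solve-∀ ℚ-ring

      -- If `g` left a second facet `r k`, the support of `e i` would be strictly smaller than that
      -- of the circuit `g`.
      others : ∀ k → k ≢ i → row (r k) g ≡ 0ℚ
      others k ne = decidable-stable (row (r k) g ≟ 0ℚ) λ kg≢0 → proj₂ (proj₂ (proj₂ C)) (e i , e-ker i ,
        (λ e0 → <⇒≢ (negative⁻¹ (- 1ℚ)) (trans (sym (e-diag i)) (dot-0 (B (r i)) e0))) ,
        (λ l le lg → le (e-support l lg)) , r k , kg≢0 , e-off k i ne)

      -- Without such a row `g` would be feasible at `y'`, and the step could be lengthened.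
      blocking : ∃ λ j → 0ℚ < row j g × Tight y' j
      blocking with any? (λ j → (0ℚ <? row j g) ×-dec tight? y' j)
      ... | yes ex = ex
      ... | no none = ⊥-elim (further (nudge py (kg , λ j t → ≮⇒≥ (λ up → none (j , up , t)))))
        where
        lem : ∀ u α ε g → u + α * g + ε * g ≡ u + (α + ε) * g
        lem = solve-∀ ℚ-ring
        further : ¬ (∃ λ ε → 0ℚ < ε × InP S (y' +[ ε ]· g))
        further (ε , ε>0 , q) = beyond (α + ε) (subst (_< α + ε) (+-identityʳ α) (+-monoʳ-< α ε>0))
          (InP-cong (λ s → trans (cong (_+ ε * g s) (y≈ s)) (lem (u s) α ε (g s))) q)

      j₀ : Fin m₂
      j₀ = proj₁ blocking
      up₀ : 0ℚ < row j₀ g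
      up₀ = proj₁ (proj₂ blocking)
      tight₀ : Tight y' j₀
      tight₀ = proj₂ (proj₂ blocking)

      v : Pt N
      v = y' ⊝ u
      row-v : ∀ j → row j v ≡ α * row j g
      row-v j = trans (dot-⊝ (B j) y' u) (trans (cong (_- row j u) (trans (dot-cong (B j) y≈) (dot-ray (B j) u α g))) (lem (row j u) (α * row j g)))
        where lem : ∀ u e → u + e - u ≡ e
              lem = solve-∀ ℚ-ring
      up-v : 0ℚ < row j₀ v
      up-v = subst (0ℚ <_) (sym (row-v j₀)) (0<* α>0 up₀)
      kv : InKer S v
      kv = ker-⊝ py pu

      -- Since g is a multiple of e i, so is every kernel vector on which the rows r k, k ≠ i, vanish.
      along : ∀ w → InKer S w → (∀ k → k ≢ i → row (r k) w ≡ 0ℚ) → ∃ λ t →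
        t * (α * a) ≡ - row (r i) w × (∀ s → w s ≡ t * v s)
      along w kw w0 = t , scale , λ s → ≡-by (rigid D kD D0 s) refl
        where
        inv = inverse⁺ (0<* α>0 a>0)
        t : ℚ
        t = - row (r i) w * proj₁ inv
        lem : ∀ w i p → - w * i * p ≡ - w * (p * i)
        lem = solve-∀ ℚ-ring
        scale : t * (α * a) ≡ - row (r i) w
        scale = trans (lem (row (r i) w) (proj₁ inv) (α * a)) (trans (cong (λ x → - row (r i) w * x) (proj₂ (proj₂ inv))) (*-identityʳ _))
        D : Pt N
        D = w ⊝ (λ s → t * v s)
        kD : InKer S D
        kD s = trans (dot-⊝ (A s) w (λ s → t * v s)) (trans (cong₂ _-_ (kw s) (ker-scale t kv s)) (+-inverseʳ 0ℚ))
        row-D : ∀ j → row j D ≡ row j w - t * (α * row j g)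
        row-D j = trans (dot-⊝ (B j) w (λ s → t * v s)) (cong (λ x → row j w - x) (trans (dot-scale (B j) t v) (cong (t *_) (row-v j))))
        lem₂ : ∀ w t α g → w - t * (α * g) ≡ w + t * (α * - g)
        lem₂ = solve-∀ ℚ-ring
        D0 : ∀ k → row (r k) D ≡ 0ℚ
        D0 k = by-cases k (k Finₚ.≟ i)
          where
          by-cases : ∀ k → Dec (k ≡ i) → row (r k) D ≡ 0ℚ
          by-cases .i (yes refl) = trans (row-D (r i)) (trans (lem₂ (row (r i) w) t α (row (r i) g)) (trans (cong (row (r i) w +_) scale) (+-inverseʳ (row (r i) w))))
          by-cases k (no ne) = trans (row-D (r k)) (trans (cong₂ (λ x y → x - t * (α * y)) (w0 k ne) (others k ne))
                        (trans (cong (λ x → 0ℚ - t * x) (*-zeroʳ α)) (trans (cong (λ x → 0ℚ - x) (*-zeroʳ t)) refl)))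

      vertex : Vertex S y'
      -- The rows `r k` with `k ≢ i` stay tight at `y'` and confine `w` to the line of `v`; the
      -- blocking row `j₀` rises along `v` and leaves only zero.
      vertex = Rigid⇒Vertex py λ w kw wt → let t , _ , eq = along w kw (λ k ne → wt (r k) (still k ne)) in
        λ s → trans (eq s) (trans (cong (_* v s) (*-cancel-0 (pos⇒≢0 up-v) (trans (*-comm (row j₀ v) t)
          (trans (sym (dot-scale (B j₀) t v)) (trans (sym (dot-cong (B j₀) eq)) (wt j₀ tight₀)))))) (*-zeroˡ (v s)))
        where
        still : ∀ k → k ≢ i → Tight y' (r k)
        still k ne = trans (dot-cong (B (r k)) y≈) (trans (dot-ray (B (r k)) u α g) (trans (cong₂ (λ x y → x + α * y) (r-tight k) (others k ne))
          (trans (cong (d (r k) +_) (*-zeroʳ α)) (+-identityʳ _))))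

      -- The rows tight along the whole step; they cut out the segment as a face. Row `r i` bounds
      -- its parameter below, row `j₀` above.
      Q : Fin m₂ → Set
      Q j = Tight u j × row j g ≡ 0ℚ
      Q? : ∀ j → Dec (Q j)
      Q? j = tight? u j ×-dec (row j g ≟ 0ℚ)

      on-segment : ∀ x → faceOf Q x → Segment S u y' x
      on-segment x (px , tx) = t , t≥0 , t≤1 , λ s → trans (lem (x s) (u s)) (cong (u s +_) (eq s))
        where
        w : Pt N
        w = x ⊝ u
        lem : ∀ x u → x ≡ u + (x - u)
        lem = solve-∀ ℚ-ring
        flat : ∀ k → k ≢ i → row (r k) w ≡ 0ℚ
        flat k ne = trans (dot-⊝ (B (r k)) x u) (trans (cong₂ _-_ (tx (r k) (r-tight k , others k ne)) (r-tight k)) (+-inverseʳ (d (r k))))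
        res = along w (ker-⊝ px pu) flat
        t : ℚ
        t = proj₁ res
        eq : ∀ s → w s ≡ t * v s
        eq = proj₂ (proj₂ res)
        t≥0 : 0ℚ ≤ t
        t≥0 = 0≤-cancel (0<* α>0 a>0) (subst (0ℚ ≤_) (trans (trans (lem₁ (d (r i)) (row (r i) x))
              (cong -_ (trans (cong (λ d → row (r i) x - d) (sym (r-tight i))) (sym (dot-⊝ (B (r i)) x u)))))
              (trans (sym (proj₁ (proj₂ res))) (*-comm t (α * a)))) (slack≥0 px (r i)))
          where lem₁ : ∀ d x → d - x ≡ - (x - d)
                lem₁ = solve-∀ ℚ-ring
        t≤1 : t ≤ 1ℚ
        t≤1 = ≤-by (0≤-cancel up-v (subst (0ℚ ≤_) value (slack≥0 px j₀))) refl
          where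
          lem₂ : ∀ y x u → y - x ≡ (y - u) - (x - u)
          lem₂ = solve-∀ ℚ-ring
          lem₃ : ∀ v t → v - t * v ≡ v * (1ℚ - t)
          lem₃ = solve-∀ ℚ-ring
          value : d j₀ - row j₀ x ≡ row j₀ v * (1ℚ - t)
          value = trans (cong (_- row j₀ x) (sym tight₀)) (trans (lem₂ (row j₀ y') (row j₀ x) (row j₀ u))
            (trans (cong₂ _-_ (sym (dot-⊝ (B j₀) y' u)) (trans (sym (dot-⊝ (B j₀) x u)) (trans (dot-cong (B j₀) eq) (dot-scale (B j₀) t v))))
            (lem₃ (row j₀ v) t)))

      in-face : ∀ x → Segment S u y' x → faceOf Q x
      in-face x (t , t≥0 , t≤1 , e) =
        ((λ s → trans (dot-cong (A s) e) (trans (dot-ray (A s) u t v) (trans (cong₂ (λ x y → x + t * y) (proj₁ pu s) (kv s))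
           (trans (cong (b s +_) (*-zeroʳ t)) (+-identityʳ (b s)))))) ,
         (λ j → subst (_≤ d j) (sym (row-x j)) (≤-by (0≤+ (0≤* (≤⇒0≤∸ t≤1) (slack≥0 pu j)) (0≤* t≥0 (slack≥0 py j)))
           (lem (d j) (row j u) t (row j y'))))) ,
        (λ { j (tu , jg) → trans (row-x j) (trans (cong₂ (λ x y → x + t * (y - row j u)) tu (row-y j tu jg))
           (trans (cong (λ x → d j + t * (d j - x)) tu) (lem₁ (d j) t))) })
        where
        row-x : ∀ j → row j x ≡ row j u + t * (row j y' - row j u)
        row-x j = trans (dot-cong (B j) e) (trans (dot-ray (B j) u t v) (cong (λ y → row j u + t * y) (dot-⊝ (B j) y' u)))
        lem : ∀ d u t y → d - (u + t * (y - u)) ≡ (1ℚ - t) * (d - u) + t * (d - y)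
        lem = solve-∀ ℚ-ring
        lem₁ : ∀ d t → d + t * (d - d) ≡ d
        lem₁ = solve-∀ ℚ-ring
        row-y : ∀ j → Tight u j → row j g ≡ 0ℚ → row j y' ≡ d j
        row-y j tu jg = trans (dot-cong (B j) y≈) (trans (dot-ray (B j) u α g) (trans (cong₂ (λ x y → x + α * y) tu jg)
          (trans (cong (d j +_) (*-zeroʳ α)) (+-identityʳ (d j)))))

      edge : Edge S u y'
      edge = Face-resp (λ x → on-segment x , in-face x) (faceOf-Face Q Q? (u , pu , λ _ → proj₁)) ,
        (ends , ends-in , ends-ind) , no-triangle
        where
        ends : Fin 2 → Pt N
        ends = u ∷ y' ∷ λ ()
        lem₀ : ∀ u y → u ≡ u + 0ℚ * (y - u)
        lem₀ = solve-∀ ℚ-ring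
        lem₁ : ∀ u y → y ≡ u + 1ℚ * (y - u)
        lem₁ = solve-∀ ℚ-ring
        ends-in : ∀ i → Segment S u y' (ends i)
        ends-in zero       = 0ℚ , ≤-refl , 0≤1 , λ s → lem₀ (u s) (y' s)
        ends-in (suc zero) = 1ℚ , 0≤1 , ≤-refl , λ s → lem₁ (u s) (y' s)
        ends-ind : AffIndep 1 ends
        ends-ind = LinIndep-cong 1 {v ∷ λ ()} {λ i s → ends (suc i) s - ends zero s} (λ { zero s → refl })
          (LinIndep-cons 0 v (λ ()) (B j₀) (λ ()) (pos⇒≢0 up-v) (λ _ _ ()))
        no-triangle : ¬ Points (Segment S u y') 2
        no-triangle (p , pin , ind) = LinIndep-2-multiples v (λ s → proj₁ (pin (suc s)) - proj₁ (pin zero))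
          (LinIndep-cong 2 {λ s c → p (suc s) c - p zero c}
            (λ s c → trans (cong₂ _-_ (proj₂ (proj₂ (proj₂ (pin (suc s)))) c) (proj₂ (proj₂ (proj₂ (pin zero))) c))
               (lem (u c) (proj₁ (pin (suc s))) (proj₁ (pin zero)) (v c))) ind)
          where lem : ∀ u t s v → (u + t * v) - (u + s * v) ≡ (t - s) * v
                lem = solve-∀ ℚ-ring

    edge-steps : ∀ k (y : Fin (suc k) → Pt N) → (∀ i → InP S (y i)) → Vertex S (y zero) →
      (∀ (i : Fin k) → CircuitStep S (y (inject₁ i)) (y (suc i))) →
      (∀ i → Vertex S (y i)) × (∀ (i : Fin k) → Edge S (y (inject₁ i)) (y (suc i)))
    edge-steps zero    y py V steps = (λ { zero → V }) , λ ()
    edge-steps (suc k) y py V steps = (λ { zero → V ; (suc i) → proj₁ later i }) , (λ { zero → Step.edge ; (suc i) → proj₂ later i })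
      where
      first = steps zero
      module Step = EdgeStep V (py (suc zero)) (proj₁ first) (proj₁ (proj₂ first)) (proj₁ (proj₂ (proj₂ first)))
        (proj₁ (proj₂ (proj₂ (proj₂ first)))) (proj₁ (proj₂ (proj₂ (proj₂ (proj₂ first))))) (proj₂ (proj₂ (proj₂ (proj₂ (proj₂ first)))))
      later = edge-steps k (λ i → y (suc i)) (λ i → py (suc i)) Step.vertex (λ i → steps (suc i))

    all-edge-walks : AllCircuitWalksAreEdgeWalks S
    all-edge-walks v₁ v₂ V₁ V₂ k y W@(start , _ , inside , steps) =
      W , edge-steps k y inside (Vertex-cong (≈-sym start) V₁) steps

-- Local product structure at a vertex

module Products {N : ℕ} (S : System N) (n' : ℕ) (bounded : Bounded S)
    (dimP : HasDim (InP S) (suc n')) (minimal : MinimalRep S) (simple : Simple S (suc n')) where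
  open System S
  open ConeEquivalences S n' bounded dimP minimal simple public

  classes = representatives m₂ _~_ _~?_ ~-refl ~-sym

  K : ℕ
  K = proj₁ classes

  R : Fin K → Fin m₂
  R = proj₁ (proj₂ classes)

  R-inj : ∀ i j → R i ~ R j → i ≡ j
  R-inj = proj₁ (proj₂ (proj₂ classes))

  R-cover : ∀ l → ∃ λ i → l ~ R i
  R-cover = proj₂ (proj₂ (proj₂ classes))

  all-facets : ExactlyFacets S (λ _ → ⊤) K
  all-facets = (λ i → RowFace (R i)) , (λ i → minimal (R i) , tt) , R-inj , λ G fG _ →
    let j , s = facet-is-row fG ; i , s' = R-cover j in i , SameSet-trans s s'

  module Corner (cone : ConeProperty) {v : Pt N} (V : Vertex S v) where
    F : Frame v
    F = frame V
    open Frame F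
    open FrameProperties F

    pv : InP S v
    pv = Vertex-InP V

    split = partition K (λ i → tight? v (R i))
    #tight #loose : ℕ
    #tight = proj₁ split
    #loose = proj₁ (proj₂ split)
    split-eq : #tight ℕ.+ #loose ≡ K
    split-eq = proj₁ (proj₂ (proj₂ split))
    module T = Enumeration (proj₁ (proj₂ (proj₂ (proj₂ split))))
    module L = Enumeration (proj₂ (proj₂ (proj₂ (proj₂ split))))

    -- Frame rows and representatives tight at `v` both list the facets through `v` once each, so
    -- there are injections both ways.
    #tight≡n : #tight ≡ n
    #tight≡n = ℕₚ.≤-antisym (Finₚ.injective⇒≤ {f = f} f-inj) (Finₚ.injective⇒≤ {f = h} h-inj)
      where
      f : Fin #tight → Fin n
      f x = proj₁ (cover (R (T.elem x)) (T.sound x))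
      f-inj : ∀ {x y} → f x ≡ f y → x ≡ y
      f-inj {x} {y} e = T.injective (R-inj _ _ (~-trans (~-sym (proj₂ (cover (R (T.elem x)) (T.sound x))))
        (subst (λ i → r i ~ R (T.elem y)) (sym e) (proj₂ (cover (R (T.elem y)) (T.sound y))))))
      class : ∀ i → ∃ λ x → r i ~ R (T.elem x)
      class i = let s , ri~ = R-cover (r i) ; x , ex = T.complete s (~-tight ri~ pv (r-tight i)) in
        x , subst (λ s → r i ~ R s) (sym ex) ri~
      h : Fin n → Fin #tight
      h i = proj₁ (class i)
      h-inj : ∀ {i k} → h i ≡ h k → i ≡ k
      h-inj {i} {k} e = r-inj i k (~-trans (proj₂ (class i)) (~-sym (subst (λ x → r k ~ R (T.elem x)) (sym e) (proj₂ (class k)))))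

    n+#loose : n ℕ.+ #loose ≡ K
    n+#loose = trans (cong (ℕ._+ #loose) (sym #tight≡n)) split-eq

    e-nonzero : ∀ i → NonZeroPt S (e i)
    e-nonzero i e0 = <⇒≢ (negative⁻¹ (- 1ℚ)) (trans (sym (e-diag i)) (dot-0 (B (r i)) e0))

    reach : ∀ i → ∃ λ α → 0ℚ < α × InP S (v +[ α ]· e i) × ∃ λ j → 0ℚ < row j (e i) × Tight (v +[ α ]· e i) j
    reach i = max-step pv (e-feasible i) (ascent pv (e-ker i) (nonZero-at (e-nonzero i)))

    α : Fin n → ℚ
    α i = proj₁ (reach i)
    α>0 : ∀ i → 0ℚ < α i
    α>0 i = proj₁ (proj₂ (reach i))
    far : Fin n → Pt N
    far i = v +[ α i ]· e i
    far-in : ∀ i → InP S (far i)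
    far-in i = proj₁ (proj₂ (proj₂ (reach i)))
    hit : Fin n → Fin m₂
    hit i = proj₁ (proj₂ (proj₂ (proj₂ (reach i))))
    hit-up : ∀ i → 0ℚ < row (hit i) (e i)
    hit-up i = proj₁ (proj₂ (proj₂ (proj₂ (proj₂ (reach i)))))
    hit-tight : ∀ i → Tight (far i) (hit i)
    hit-tight i = proj₂ (proj₂ (proj₂ (proj₂ (proj₂ (reach i)))))

    rising-loose : ∀ l i → 0ℚ < row l (e i) → ¬ Tight v l
    rising-loose l i up t = <-irrefl refl (<-≤-trans up (proj₂ (e-feasible i) l t))

    far-keeps : ∀ i k → k ≢ i → Tight (far i) (r k)
    far-keeps i k ne = trans (sym (row-ray (α i) (e i) (r k))) (trans (cong₂ (λ x y → x + α i * y) (r-tight k) (e-off k i ne))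
      (trans (cong (d (r k) +_) (*-zeroʳ (α i))) (+-identityʳ (d (r k)))))

    -- The frame rows other than `r i` confine `z` to the line of `e i`, where row `l` vanishes only
    -- at zero.
    on-axis : ∀ i l z → 0ℚ < row l (e i) → InKer S z → (∀ k → k ≢ i → row (r k) z ≡ 0ℚ) → row l z ≡ 0ℚ → ∀ s → z s ≡ 0ℚ
    on-axis i l z up kz z0 lz s = trans (lem (z s) x (e i s)) (trans (cong₂ (λ t x → t - x * e i s) (D0 s) x0)
        (trans (cong (λ t → 0ℚ - t) (*-zeroˡ (e i s))) refl))
      where
      lem : ∀ z x e → z ≡ (z + x * e) - x * e
      lem = solve-∀ ℚ-ring
      x : ℚ
      x = row (r i) z
      D : Pt N
      D = z +[ x ]· e i
      lem₁ : ∀ x → x + x * - 1ℚ ≡ 0ℚ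
      lem₁ = solve-∀ ℚ-ring
      rows : ∀ k → Dec (k ≡ i) → row (r k) D ≡ 0ℚ
      rows k (yes refl) = trans (dot-ray (B (r k)) z x (e k)) (trans (cong (λ t → row (r k) z + x * t) (e-diag k)) (lem₁ x))
      rows k (no ne) = trans (dot-ray (B (r k)) z x (e i)) (trans (cong₂ (λ s t → s + x * t) (z0 k ne) (e-off k i ne))
        (trans (cong (0ℚ +_) (*-zeroʳ x)) refl))
      D0 : ∀ s → D s ≡ 0ℚ
      D0 = rigid D (ker-ray x kz (e-ker i)) (λ k → rows k (k Finₚ.≟ i))
      x0 : x ≡ 0ℚ
      x0 = *-cancel-0 (pos⇒≢0 up) (trans (*-comm (row l (e i)) x) (trans (sym (+-identityˡ (x * row l (e i))))
        (trans (cong (_+ x * row l (e i)) (sym lz)) (trans (sym (dot-ray (B l) z x (e i))) (dot-0 (B l) D0)))))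

    far-vertex : ∀ i → Vertex S (far i)
    far-vertex i = Rigid⇒Vertex (far-in i) λ z kz tz → on-axis i (hit i) z (hit-up i) kz
      (λ k ne → tz (r k) (far-keeps i k ne)) (tz (hit i) (hit-tight i))

    -- At the far vertex `neg (e i)` is feasible and decreases row `l`; the cone property there
    -- permits this only if `l` is tight.
    hits : ∀ l i → 0ℚ < row l (e i) → Tight (far i) l
    hits l i up = decidable-stable (tight? (far i) l) λ nt →
      <-irrefl refl (<-≤-trans (-<0 up) (subst (0ℚ ≤_) (dot-neg (B l) (e i)) (cone (far-vertex i) back l nt)))
      where
      lem : ∀ v a x → (v + a * x) - v ≡ a * x
      lem = solve-∀ ℚ-ring
      back : Feasible (far i) (neg (e i))
      back = ker-neg (e-ker i) , λ j t → subst (_≤ 0ℚ) (sym (dot-neg (B j) (e i))) (-≤0 (0≤-cancel (α>0 i)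
        (subst (0ℚ ≤_) (trans (cong (_- row j v) (trans (sym t) (sym (row-ray (α i) (e i) j)))) (lem (row j v) (α i) (row j (e i)))) (slack≥0 pv j))))

    -- Both rows are tight at the far vertex. If their facets differed, the edge `z` there that
    -- leaves only facet `l` would keep `l'` and every `r m` with `m ≢ i`, and `on-axis` would make
    -- it zero.
    hits-once : ∀ l l' i → 0ℚ < row l (e i) → 0ℚ < row l' (e i) → l ~ l'
    hits-once l l' i up up' = compare-classes (F'.cover l (hits l i up)) (F'.cover l' (hits l' i up'))
      where
      module F' = Frame (frame (far-vertex i))
      compare-classes : (∃ λ k → F'.r k ~ l) → (∃ λ k → F'.r k ~ l') → l ~ l'
      compare-classes (k , s) (k' , s') = by-cases (k' Finₚ.≟ k)
        where
        z : Pt N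
        z = F'.e k
        kz : InKer S z
        kz = F'.e-ker k
        others : ∀ m → m ≢ i → row (r m) z ≡ 0ℚ
        others m ne = let k'' , s'' = F'.cover (r m) (far-keeps i m ne) in
          ~-kernel s'' z kz (F'.e-off k'' k λ k''≡k → rising-loose l i up
            (~-tight (~-trans (~-sym (subst (λ k → F'.r k ~ r m) k''≡k s'')) s) pv (r-tight m)))
        by-cases : Dec (k' ≡ k) → l ~ l'
        by-cases (yes k'≡k) = ~-trans (~-sym s) (subst (λ k → F'.r k ~ l') k'≡k s')
        by-cases (no ne) = ⊥-elim (<⇒≢ (negative⁻¹ (- 1ℚ)) (trans (sym (F'.e-diag k)) (dot-0 (B (F'.r k))
          (on-axis i l' z up' kz others (~-kernel s' z kz (F'.e-off k' k ne))))))

    loose : Fin #loose → Fin m₂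
    loose s = R (L.elem s)

    loose-inj : ∀ s t → loose s ~ loose t → s ≡ t
    loose-inj s t e = L.injective (R-inj _ _ e)

    loose-cover : ∀ l → ¬ Tight v l → ∃ λ s → loose s ~ l
    loose-cover l nt = let i , l~ = R-cover l ; s , es = L.complete i (λ t → nt (~-tight (~-sym l~) pv t)) in
      s , subst (λ i → R i ~ l) (sym es) (~-sym l~)

    axis : ∀ s → ∃ λ i → 0ℚ < row (loose s) (e i)
    axis s = rising-edge pv (loose s) (L.sound s)

    ι : Fin #loose → Fin n
    ι s = proj₁ (axis s)

    ι-up : ∀ s → 0ℚ < row (loose s) (e (ι s))
    ι-up s = proj₂ (axis s)

    -- By the cone property the row could only rise along this edge, and the edge already raises
    -- `loose t`, hence no other facet off `v`.
    cross : ∀ s t → t ≢ s → row (loose s) (e (ι t)) ≡ 0ℚ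
    cross s t ne = decidable-stable (row (loose s) (e (ι t)) ≟ 0ℚ) λ nz → ne (sym (loose-inj s t
      (hits-once (loose s) (loose t) (ι t) (≤∧≢⇒< (cone V (e-feasible (ι t)) (loose s) (L.sound s)) (nz ∘ sym)) (ι-up t))))

    ι-inj : ∀ {s t} → ι s ≡ ι t → s ≡ t
    ι-inj {s} {t} eq = decidable-stable (s Finₚ.≟ t) λ ne →
      pos⇒≢0 (ι-up s) (trans (cong (λ i → row (loose s) (e i)) eq) (cross s t (ne ∘ sym)))

    #loose≤n : #loose ℕ.≤ n
    #loose≤n = Finₚ.injective⇒≤ {f = ι} ι-inj

    1≤#loose : 1 ℕ.≤ #loose
    1≤#loose = positive-size (proj₁ (loose-cover (hit zero) (rising-loose (hit zero) zero (hit-up zero))))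
      where
      positive-size : ∀ {k} → Fin k → 1 ℕ.≤ k
      positive-size zero    = ℕ.s≤s ℕ.z≤n
      positive-size (suc i) = ℕ.s≤s ℕ.z≤n

    -- Full edges up to the far vertices, so that the parameter `1ℚ` exactly exhausts the slack of
    -- the facet being approached.
    w : Fin #loose → Pt N
    w s j = α (ι s) * e (ι s) j

    w-ker : ∀ s → InKer S (w s)
    w-ker s = ker-scale (α (ι s)) (e-ker (ι s))

    row-w : ∀ j s → row j (w s) ≡ α (ι s) * row j (e (ι s))
    row-w j s = dot-scale (B j) (α (ι s)) (e (ι s))

    row-w-flat : ∀ j s → row j (e (ι s)) ≡ 0ℚ → row j (w s) ≡ 0ℚ
    row-w-flat j s z = trans (row-w j s) (trans (cong (α (ι s) *_) z) (*-zeroʳ (α (ι s))))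

    row-w-rising : ∀ j s → 0ℚ < row j (e (ι s)) → row j (w s) ≡ d j - row j v
    row-w-rising j s up = trans (row-w j s) (trans (lem (row j v) (α (ι s) * row j (e (ι s))))
        (cong (_- row j v) (trans (row-ray (α (ι s)) (e (ι s)) j) (hits j (ι s) up))))
      where lem : ∀ v x → x ≡ v + x - v
            lem = solve-∀ ℚ-ring

    row-comb-single : ∀ j s (c : Fin #loose → ℚ) → (∀ t → t ≢ s → row j (e (ι t)) ≡ 0ℚ) →
      row j (comb #loose c w) ≡ c s * row j (w s)
    row-comb-single j s c z = trans (dot-comb (B j) #loose c w) (sumF-single #loose s (λ t ne →
      trans (cong (c t *_) (row-w-flat j t (z t ne))) (*-zeroʳ (c t))))

    row-comb-flat : ∀ j (c : Fin #loose → ℚ) → (∀ s → row j (e (ι s)) ≡ 0ℚ) → row j (comb #loose c w) ≡ 0ℚ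
    row-comb-flat j c z = trans (dot-comb (B j) #loose c w) (sumF-0 #loose (λ s →
      trans (cong (c s *_) (row-w-flat j s (z s))) (*-zeroʳ (c s))))

    w-indep : LinIndep #loose w
    w-indep c z s = *-cancel-0 (pos⇒≢0 (subst (0ℚ <_) (sym (row-w (loose s) s)) (0<* (α>0 (ι s)) (ι-up s))))
      (trans (*-comm (row (loose s) (w s)) (c s)) (trans (sym (row-comb-single (loose s) s c (cross s))) (dot-0 (B (loose s)) z)))

    -- The rows constant on the span of the chosen edges at `v`; the face they define is the box.
    Q : Fin m₂ → Set
    Q j = Tight v j × (∀ s → row j (e (ι s)) ≡ 0ℚ)

    Q? : ∀ j → Dec (Q j)
    Q? j = tight? v j ×-dec all? (λ s → row j (e (ι s)) ≟ 0ℚ)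

    Box : PSet N
    Box x = ∃ λ (c : Fin #loose → ℚ) → (∀ i → (0ℚ ≤ c i) × (c i ≤ 1ℚ)) × x ≈ (λ j → v j + sumF #loose (λ i → c i * w i j))

    box-in-face : ∀ x → Box x → faceOf Q x
    box-in-face x (c , bounds , e≈) = ((λ s → trans (dot-cong (A s) e≈′) (trans (dot-ray (A s) v 1ℚ E)
        (trans (cong₂ (λ x y → x + 1ℚ * y) (proj₁ pv s) (ker-comb #loose c w w-ker s)) (+-identityʳ (b s))))) ,
        (λ j → subst (_≤ d j) (sym (row-x j)) (bound j (tight? v j)))) ,
        λ { j (t , z) → trans (row-x j) (trans (cong₂ _+_ t (row-comb-flat j c z)) (+-identityʳ (d j))) }
      where
      E : Pt N
      E = comb #loose c w
      lem : ∀ v x → v + x ≡ v + 1ℚ * x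
      lem = solve-∀ ℚ-ring
      e≈′ : x ≈ (v +[ 1ℚ ]· E)
      e≈′ s = trans (e≈ s) (lem (v s) (E s))
      row-x : ∀ j → row j x ≡ row j v + row j E
      row-x j = trans (dot-cong (B j) e≈′) (trans (dot-ray (B j) v 1ℚ E) (sym (lem (row j v) (row j E))))
      lem₂ : ∀ d c v → d - (v + c * (d - v)) ≡ (1ℚ - c) * (d - v)
      lem₂ = solve-∀ ℚ-ring
      lem₃ : ∀ d e → d - (d + e) ≡ - e
      lem₃ = solve-∀ ℚ-ring
      -- A tight row does not rise along any edge. A loose row sees just one of the `w s`, and `c s`
      -- times its slack is at most its slack.
      bound : ∀ j → Dec (Tight v j) → row j v + row j E ≤ d j
      bound j (yes t) = ≤-by (0≤- E≤0) (trans (cong (λ x → d j - (x + row j E)) t) (lem₃ (d j) (row j E)))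
        where
        E≤0 : row j E ≤ 0ℚ
        E≤0 = subst₂ _≤_ (sym (dot-comb (B j) #loose c w)) (sumF-0 #loose {λ _ → 0ℚ} (λ _ → refl)) (sumF-mono #loose λ s →
          *-≤0 (proj₁ (bounds s)) (subst (_≤ 0ℚ) (sym (row-w j s)) (*-≤0 (<⇒≤ (α>0 (ι s))) (proj₂ (e-feasible (ι s)) j t))))
      bound j (no nt) = via (loose-cover j nt)
        where
        via : (∃ λ s → loose s ~ j) → row j v + row j E ≤ d j
        via (s , s~j) = ≤-by (0≤* (≤⇒0≤∸ (proj₂ (bounds s))) (slack≥0 pv j))
          (trans (cong (λ x → d j - (row j v + x)) (trans (row-comb-single j s c (λ t ne → ~-kernel s~j _ (e-ker (ι t)) (cross s t ne)))
             (cong (c s *_) (row-w-rising j s rising)))) (lem₂ (d j) (c s) (row j v)))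
          where
          rising : 0ℚ < row j (e (ι s))
          rising = let μ , μ>0 , eq = ~-proportional s~j in subst (0ℚ <_) (sym (eq _ (e-ker (ι s)))) (0<* μ>0 (ι-up s))

    face-in-box : ∀ x → faceOf Q x → Box x
    face-in-box x (px , tx) = c , (λ s → c≥0 s , c≤1 s) , λ s → ≡-by (D0 s) (lem (x s) (v s) (comb #loose c w s))
      where
      lem : ∀ x v e → x - (v + e) ≡ (x - v) - e
      lem = solve-∀ ℚ-ring
      y : Pt N
      y = x ⊝ v
      ky : InKer S y
      ky = ker-⊝ px pv
      β : Fin #loose → ℚ
      β s = proj₁ (inverse⁺ (α>0 (ι s)))
      β>0 : ∀ s → 0ℚ < β s
      β>0 s = proj₁ (proj₂ (inverse⁺ (α>0 (ι s))))
      αβ : ∀ s → α (ι s) * β s ≡ 1ℚ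
      αβ s = proj₂ (proj₂ (inverse⁺ (α>0 (ι s))))
      -- The coordinate of `y` along `e (ι s)`, measured in full edge lengths. Coordinates along
      -- edges outside the image of `ι` vanish because the rows in `Q` are tight at `x`.
      c : Fin #loose → ℚ
      c s = - row (r (ι s)) y * β s
      row-y : ∀ i → row (r i) y ≡ row (r i) x - d (r i)
      row-y i = trans (dot-⊝ (B (r i)) x v) (cong (λ t → row (r i) x - t) (r-tight i))
      c≥0 : ∀ s → 0ℚ ≤ c s
      c≥0 s = 0≤* (subst (0ℚ ≤_) (trans (lem₁ (d (r (ι s))) (row (r (ι s)) x)) (cong -_ (sym (row-y (ι s))))) (slack≥0 px (r (ι s)))) (<⇒≤ (β>0 s))
        where lem₁ : ∀ d x → d - x ≡ - (x - d)
              lem₁ = solve-∀ ℚ-ring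
      D : Pt N
      D = y ⊝ comb #loose c w
      kD : InKer S D
      kD s = trans (dot-⊝ (A s) y (comb #loose c w)) (trans (cong₂ _-_ (ky s) (ker-comb #loose c w w-ker s)) (+-inverseʳ 0ℚ))
      rows : ∀ i → Dec (∃ λ s → ι s ≡ i) → row (r i) D ≡ 0ℚ
      rows i (yes (s , refl)) = trans (dot-⊝ (B (r i)) y (comb #loose c w)) (trans (cong (λ t → row (r i) y - t)
          (trans (row-comb-single (r i) s c (λ t ne → e-off (ι s) (ι t) (λ eq → ne (sym (ι-inj eq)))))
            (cong (c s *_) (trans (row-w (r i) s) (cong (α (ι s) *_) (e-diag (ι s)))))))
          (trans (lem₂ (row (r i) y) (β s) (α (ι s))) (trans (cong (λ t → row (r i) y * (1ℚ - t)) (αβ s)) (*-zeroʳ (row (r i) y)))))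
        where lem₂ : ∀ y β α → y - - y * β * (α * - 1ℚ) ≡ y * (1ℚ - α * β)
              lem₂ = solve-∀ ℚ-ring
      rows i (no none) = trans (dot-⊝ (B (r i)) y (comb #loose c w)) (trans (cong₂ _-_
          (trans (row-y i) (trans (cong (_- d (r i)) (tx (r i) (r-tight i , flat))) (+-inverseʳ (d (r i)))))
          (row-comb-flat (r i) c flat)) (+-inverseʳ 0ℚ))
        where
        flat : ∀ s → row (r i) (e (ι s)) ≡ 0ℚ
        flat s = e-off i (ι s) (λ eq → none (s , sym eq))
      D0 : ∀ s → D s ≡ 0ℚ
      D0 = rigid D kD (λ i → rows i (any? (λ s → ι s Finₚ.≟ i)))
      c≤1 : ∀ s → c s ≤ 1ℚ
      c≤1 s = ≤-by (0≤-cancel (slack>0 pv l (L.sound s)) (subst (0ℚ ≤_) value (slack≥0 px l))) refl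
        where
        l : Fin m₂
        l = loose s
        lem₃ : ∀ d x v → d - x ≡ (d - v) - (x - v)
        lem₃ = solve-∀ ℚ-ring
        lem₄ : ∀ p c → p - c * p ≡ p * (1ℚ - c)
        lem₄ = solve-∀ ℚ-ring
        row-ly : row l x - row l v ≡ c s * (d l - row l v)
        row-ly = trans (sym (dot-⊝ (B l) x v)) (trans (≡-by (dot-0 (B l) D0) (sym (dot-⊝ (B l) y (comb #loose c w))))
          (trans (row-comb-single l s c (cross s)) (cong (c s *_) (row-w-rising l s (ι-up s)))))
        value : d l - row l x ≡ (d l - row l v) * (1ℚ - c s)
        value = trans (lem₃ (d l) (row l x) (row l v)) (trans (cong (λ t → (d l - row l v) - t) row-ly) (lem₄ (d l - row l v) (c s)))

    parallelotope-face : ∃ λ G → Face S G × G v × IsParallelotope #loose G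
    parallelotope-face = faceOf Q , faceOf-Face Q Q? (v , pv , λ _ → proj₁) , (pv , λ _ → proj₁) ,
      v , w , w-indep , λ x → face-in-box x , box-in-face x

  module _ (cone : ConeProperty) where

    some-vertex : ¬ ¬ (∃ (Vertex S))
    some-vertex none = let j , _ = direction in
        walk-to-vertex _ centre j ℕₚ.≤-refl centre-InP λ { (v , _ , _ , V , _) → none (v , V) }
      where
      base : ∀ i → InP S (basePts i)
      base = proj₁ (proj₂ (proj₁ dimP))
      first : Pt N
      first = basePts (suc zero) ⊝ basePts zero
      first≢0 : NonZeroPt S first
      first≢0 z = 1≢0 (proj₂ (proj₂ (proj₁ dimP)) (1ℚ ∷ λ _ → 0ℚ) (λ j → trans
        (cong₂ _+_ (trans (cong (1ℚ *_) (z j)) refl) (sumF-0 n' (λ i → *-zeroˡ (basePts (suc (suc i)) j - basePts zero j)))) refl) zero)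
      direction : ∃ λ j → 0ℚ < row j first
      direction = ascent (base zero) (ker-⊝ (base (suc zero)) (base zero)) (nonZero-at first≢0)

    -- The value of `d`: the number of facets missing a vertex, computed without one, since
    -- `some-vertex` is only a double negation. The bounds below are decidable and may use it.
    excess : ℕ
    excess = K ℕ.∸ n

    #loose≡excess : ∀ {v} (V : Vertex S v) → Corner.#loose cone V ≡ excess
    #loose≡excess V = trans (sym (ℕₚ.m+n∸m≡n n (Corner.#loose cone V))) (cong (ℕ._∸ n) (Corner.n+#loose cone V))

    1≤excess : 1 ℕ.≤ excess
    1≤excess = decidable-stable (1 ℕₚ.≤? excess) λ bad → some-vertex λ { (v , V) →
      bad (subst (1 ℕ.≤_) (#loose≡excess V) (Corner.1≤#loose cone V)) }

    excess≤n : excess ℕ.≤ n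
    excess≤n = decidable-stable (excess ℕₚ.≤? n) λ bad → some-vertex λ { (v , V) →
      bad (subst (ℕ._≤ n) (#loose≡excess V) (Corner.#loose≤n cone V)) }

    n+excess : n ℕ.+ excess ≡ K
    n+excess = decidable-stable (n ℕ.+ excess ℕₚ.≟ K) λ bad → some-vertex λ { (v , V) →
      bad (trans (cong (n ℕ.+_) (sym (#loose≡excess V))) (Corner.n+#loose cone V)) }

    parallelotope : NDParallelotope S n excess
    parallelotope = dimP , subst (ExactlyFacets S (λ _ → ⊤)) (sym n+excess) all-facets , FromCone.symmetric cone ,
      λ v V → subst (λ k → ∃ λ G → Face S G × G v × IsParallelotope k G) (#loose≡excess V) (Corner.parallelotope-face cone V)

theorem7 : ∀ (N : ℕ) (S : System N) (n : ℕ) →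
    Bounded S → HasDim (InP S) n → 1 ℕ.≤ n → MinimalRep S → Simple S n →
    (AllCircuitWalksAreEdgeWalks S → ∃ λ d → 1 ℕ.≤ d × d ℕ.≤ n × NDParallelotope S n d) ×
    ((∃ λ d → 1 ℕ.≤ d × d ℕ.≤ n × NDParallelotope S n d) → AllCircuitWalksAreEdgeWalks S)
theorem7 N S (suc n') bounded dimP _ minimal simple =
  (λ all-edges → let cone = FromCircuits.cone all-edges in
    excess cone , 1≤excess cone , excess≤n cone , parallelotope cone) ,
  (λ { (_ , _ , _ , _ , _ , symmetric , _) → FromCone.all-edge-walks (FromSymmetric.cone symmetric) })
  where open Products S n' bounded dimP minimal simple
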